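{- Let $r$ be a positive integer and let $G$ be a depth-two claw. If $\mu(G) \geq 2r-1$, then $G$ is strictly $r$-EKR.
   Context: Graphs are finite, simple and undirected. An independent set of a graph is a set of pairwise non-adjacent vertices, and $\mu(G)$ denotes the minimum size of a maximal (with respect to inclusion) independent set of $G$. For a graph $G$ and an integer $r \geq 1$, $\mathcal{I}^{(r)}(G)$ denotes the family of independent sets of $G$ of cardinality $r$. For a vertex $v$ of $G$, $\mathcal{I}^{(r)}_v(G) = \{A \in \mathcal{I}^{(r)}(G) : v \in A\}$; this family is called the $r$-star centred at $v$, and $v$ is its centre. A family of sets is pairwise intersecting if any two of its members have nonempty intersection. $G$ is strictly $r$-EKR if every pairwise intersecting family $\mathcal{A} \subseteq \mathcal{I}^{(r)}(G)$ that is not an $r$-star is smaller than the largest $r$-star of $G$. An elongated claw is a tree with one vertex designated as its root, such that every vertex other than the root has degree 1 or 2 (the root may have any degree, possibly 1 or 2). A vertex of degree 1 is called a leaf, and a path from the root to a leaf is called a limb. A depth-two claw is an elongated claw in which every leaf is at distance 2 from the root, that is, every limb contains exactly two edges. -}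

module Defs where

open import Data.Fin.Base using (Fin)
open import Data.Fin.Properties using (all?)
open import Data.Fin.Subset using (Subset; inside; outside; _∈_; _∩_; _⊂_; ∣_∣; Nonempty)
open import Data.Fin.Subset.Properties using (_∈?_; _⊂?_; anySubset?)
open import Data.List.Base using (List; []; _∷_; _++_; map; filter; length; allFin)
open import Data.List.Extrema.Nat using (min; max)
open import Data.List.Relation.Unary.Unique.Propositional using (Unique)
open import Data.Nat.Base using (ℕ; zero; suc; _≤_; _<_)
open import Data.Nat.Properties using (_≟_)
open import Data.Product.Base using (Σ-syntax; ∃-syntax; _×_)
open import Data.Sum.Base using (_⊎_)
open import Data.Vec.Base using ([]; _∷_)
open import Level using (0ℓ)
open import Relation.Binary.Construct.Closure.ReflexiveTransitive using (Star; ε; _◅_)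
open import Relation.Binary.Core using (Rel)
import Relation.Binary.Definitions as B
open import Relation.Binary.PropositionalEquality.Core using (_≡_; _≢_)
open import Relation.Nullary.Decidable using (¬?; _×-dec_; _→-dec_)
open import Relation.Nullary.Negation using (¬_)
open import Relation.Unary using (Pred; Decidable; _≐_)
  renaming (_⊆_ to _⊆ᵖ_)

-- Decidability of adjacency loses no generality for finite graphs and makes
-- every cardinality below computable.
record Graph (n : ℕ) : Set₁ where
  infix 4 _~_ _~?_
  field
    _~_       : Rel (Fin n) 0ℓ
    _~?_      : B.Decidable _~_
    ~-sym     : B.Symmetric _~_
    ~-irrefl  : B.Irreflexive _≡_ _~_

subsets : ∀ n → List (Subset n)
subsets zero    = [] ∷ []
subsets (suc n) = map (outside ∷_) (subsets n) ++ map (inside ∷_) (subsets n)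

-- Families of vertex sets are decidable predicates; as `subsets n` lists each
-- subset exactly once, this is the number of members of the family.
card : ∀ {n} {𝒜 : Pred (Subset n) 0ℓ} → Decidable 𝒜 → ℕ
card {n} 𝒜? = length (filter 𝒜? (subsets n))

module _ {n : ℕ} (G : Graph n) where
  open Graph G

  degree : Fin n → ℕ
  degree v = length (filter (v ~?_) (allFin n))

  Walk : Fin n → Fin n → Set
  Walk = Star _~_

  walkLength : ∀ {u v} → Walk u v → ℕ
  walkLength ε       = 0
  walkLength (_ ◅ p) = suc (walkLength p)

  vertices : ∀ {u v} → Walk u v → List (Fin n)
  vertices {u} ε       = u ∷ []
  vertices {u} (_ ◅ p) = u ∷ vertices p

  IsPath : ∀ {u v} → Walk u v → Set
  IsPath p = Unique (vertices p)

  Connected : Set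
  Connected = ∀ u v → Walk u v

  -- A cycle is a path with at least two edges together with an edge joining
  -- its end to its start.
  HasCycle : Set
  HasCycle = ∃[ u ] ∃[ v ] Σ[ p ∈ Walk u v ] IsPath p × 2 ≤ walkLength p × v ~ u

  IsTree : Set
  IsTree = Connected × ¬ HasCycle

  Distance : Fin n → Fin n → ℕ → Set
  Distance u v d =
    (Σ[ p ∈ Walk u v ] walkLength p ≡ d) × (∀ (p : Walk u v) → d ≤ walkLength p)

  IsElongatedClaw : Fin n → Set
  IsElongatedClaw root =
    IsTree × (∀ v → v ≢ root → degree v ≡ 1 ⊎ degree v ≡ 2)

  -- The root is not counted as a leaf even when its degree is 1, so that the
  -- claw with a single limb (a three-vertex path rooted at one end) is included.
  IsLeaf : Fin n → Fin n → Set
  IsLeaf root v = v ≢ root × degree v ≡ 1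

  IsDepthTwoClaw : Fin n → Set
  IsDepthTwoClaw root =
    IsElongatedClaw root × (∀ v → IsLeaf root v → Distance root v 2)

  Independent : Pred (Subset n) 0ℓ
  Independent A = ∀ u v → u ∈ A → v ∈ A → ¬ u ~ v

  independent? : Decidable Independent
  independent? A = all? λ u → all? λ v →
    (u ∈? A) →-dec (v ∈? A) →-dec ¬? (u ~? v)

  MaximalIndependent : Pred (Subset n) 0ℓ
  MaximalIndependent A = Independent A × ¬ (∃[ B ] Independent B × A ⊂ B)

  maximalIndependent? : Decidable MaximalIndependent
  maximalIndependent? A =
    independent? A ×-dec ¬? (anySubset? λ B → independent? B ×-dec (A ⊂? B))

  -- The first argument n of `min` is only a base value: a maximal independent
  -- set always exists and has at most n elements, so it never alters the minimum.
  μ : ℕ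
  μ = min n (map ∣_∣ (filter maximalIndependent? (subsets n)))

  𝓘 : ℕ → Pred (Subset n) 0ℓ
  𝓘 r A = Independent A × ∣ A ∣ ≡ r

  𝓘? : ∀ r → Decidable (𝓘 r)
  𝓘? r A = independent? A ×-dec (∣ A ∣ ≟ r)

  star : ℕ → Fin n → Pred (Subset n) 0ℓ
  star r v A = 𝓘 r A × v ∈ A

  star? : ∀ r v → Decidable (star r v)
  star? r v A = 𝓘? r A ×-dec (v ∈? A)

  IsStar : ℕ → Pred (Subset n) 0ℓ → Set
  IsStar r 𝒜 = ∃[ v ] 𝒜 ≐ star r v

  largestStarSize : ℕ → ℕ
  largestStarSize r = max 0 (map (λ v → card (star? r v)) (allFin n))

  Intersecting : Pred (Subset n) 0ℓ → Set
  Intersecting 𝒜 = ∀ A B → 𝒜 A → 𝒜 B → Nonempty (A ∩ B)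

  StrictlyEKR : ℕ → Set₁
  StrictlyEKR r = ∀ {𝒜 : Pred (Subset n) 0ℓ} (𝒜? : Decidable 𝒜) →
    𝒜 ⊆ᵖ 𝓘 r → Intersecting 𝒜 → ¬ IsStar r 𝒜 → card 𝒜? < largestStarSize r

{-# OPTIONS --safe #-}

-- An independent r-set avoiding the root is a choice of inner vertex, leaf or nothing
-- on each limb; one containing the root is the root with r - 1 leaves. Given an
-- intersecting family, replace inner vertices by leaves, limb after limb, whenever the
-- result is new. This preserves the size of the family, and afterwards any two members,
-- not both containing the root, share a leaf. A set S of s leaves extends to
-- C(k - s, r - s) independent r-sets avoiding the root with leaf set S, so it suffices
-- to bound the number of leaf sets of each size s. For s < r this is the
-- Erdős–Ko–Rado theorem on the k limbs, as k ≥ 2r - 1. For s = r, EKR fails when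
-- k = 2r - 1, but the leaf sets of size r and the members containing the root together
-- form an intersecting r-uniform family on k + 1 ≥ 2r points (root and leaves). All
-- these bounds are attained by the star of a leaf.
-- For strictness, a family as large as this star must, after compression, have a
-- member with exactly one leaf; then all members contain that leaf y. The original
-- family contains every r-set of the root, y and further leaves, and this prevents
-- its members from containing the neighbour of y instead of y.
module Submission where

open import Defs
open import Data.Bool.Base using (Bool; true; false; not; _∧_; _∨_; T; if_then_else_)
open import Data.Bool.Properties using (T?; T-∧; T-∨)
open import Data.Empty using (⊥-elim)
import Data.Fin.Base as Fin
import Data.Fin.Properties as Fin
open import Data.Fin.Base using (Fin)
open import Data.Fin.Subset using (Subset; inside; outside; ∣_∣; ∁; _∈_; _⊂_; ⁅_⁆)
open import Data.Fin.Subset.Properties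
  using (x∈p∩q⁻; p⊂q⇒∣p∣<∣q∣; ∣⁅x⁆∣≡1; x∈⁅x⁆; x∈⁅y⁆⇒x≡y; ∣p∣≤n)
open import Data.List.Base as List using (List; []; _∷_; _++_; length; filter; allFin)
open import Data.List.Membership.Propositional using () renaming (_∈_ to _∈ₗ_; _∉_ to _∉ₗ_)
open import Data.List.Membership.Propositional.Properties
  using (∈-++⁺ˡ; ∈-++⁺ʳ; ∈-++⁻; ∈-∃++; ∈-map⁺; ∈-map⁻; ∈-filter⁺; ∈-filter⁻; ∈-tabulate⁺; ∈-tabulate⁻; ∈-allFin; ∈-lookup)
import Data.List.Properties as List
import Data.List.Relation.Unary.All as All
open import Data.List.Relation.Unary.All using ([]; _∷_)
open import Data.List.Relation.Unary.AllPairs using ([]; _∷_)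
open import Data.List.Relation.Unary.Any as Any using (here; there; index)
open import Data.List.Relation.Unary.Any.Properties using (lookup-index)
open import Data.List.Relation.Unary.Unique.Propositional using (Unique)
import Data.List.Relation.Unary.Unique.Propositional.Properties as Unique
open import Data.Nat.Base
open import Data.Nat.Properties
open import Algebra.Properties.CommutativeSemigroup +-commutativeSemigroup using (interchange)
import Data.List.Extrema ≤-totalOrder as Extrema
open import Data.Product.Base using (Σ-syntax; ∃-syntax; _×_; _,_; proj₁; proj₂; swap)
import Data.Sum.Base as Sum
open import Data.Sum.Base using (_⊎_; inj₁; inj₂; [_,_]′)
open import Data.Unit.Base using (tt)
open import Data.Vec.Base using (Vec; []; _∷_; lookup; map; tabulate; replicate)
open import Data.Vec.Properties
  using (lookup-map; lookup∘tabulate; tabulate∘lookup; tabulate-cong; lookup⇒[]=; []=⇒lookup; lookup-replicate; ∷-injectiveʳ)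
open import Function.Base using (_∘_; case_of_; id)
open import Function.Bundles using (Equivalence)
open import Level using (0ℓ)
open import Relation.Binary.Construct.Closure.ReflexiveTransitive using (ε; _◅_)
open import Relation.Binary.PropositionalEquality
  using (_≡_; _≢_; refl; sym; trans; cong; cong₂; subst; subst₂; module ≡-Reasoning)
open import Relation.Nullary.Decidable using (Dec; yes; no; does; _×-dec_; ¬?)
open import Relation.Nullary.Negation using (¬_; contradiction)
open import Relation.Unary using (Pred; Decidable) renaming (_⊆_ to _⊆ᵖ_)

-- The Erdős–Ko–Rado theorem

∧-T : ∀ {a b} → T (a ∧ b) → T a × T b
∧-T = Equivalence.to T-∧

T-∧-intro : ∀ {a b} → T a → T b → T (a ∧ b)
T-∧-intro p q = Equivalence.from T-∧ (p , q)

∨-T : ∀ {a b} → T (a ∨ b) → T a ⊎ T b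
∨-T = Equivalence.to T-∨

T-∨-intro : ∀ {a b} → T a ⊎ T b → T (a ∨ b)
T-∨-intro = Equivalence.from T-∨

𝟙 : Bool → ℕ
𝟙 true  = 1
𝟙 false = 0

𝟙-mono : ∀ {a b} → (T a → T b) → 𝟙 a ≤ 𝟙 b
𝟙-mono {false}        _ = z≤n
𝟙-mono {true} {true}  _ = ≤-refl
𝟙-mono {true} {false} h = ⊥-elim (h tt)

𝟙-disjoint : ∀ {a b c} → (T a → T c) → (T b → T c) → (T a → ¬ T b) → 𝟙 a + 𝟙 b ≤ 𝟙 c
𝟙-disjoint {false}        _ g _ = 𝟙-mono g
𝟙-disjoint {true} {false} f _ _ = 𝟙-mono f
𝟙-disjoint {true} {true}  _ _ d = ⊥-elim (d tt tt)

𝟙-∨-∧ : ∀ a b → 𝟙 (a ∨ b) + 𝟙 (a ∧ b) ≡ 𝟙 a + 𝟙 b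
𝟙-∨-∧ false b = +-identityʳ (𝟙 b)
𝟙-∨-∧ true  b = refl

-- Boolean-valued, so that a slice at the first point is a composition and the number of members is
-- computed by recursion on the points.
Family : ℕ → Set
Family m = Subset m → Bool

-- The relation is a parameter because several kinds of sharing occur: a point of two sets
-- (`BothIn`), a vertex (`Common`) or a leaf (`BothLeaf`) of two limb vectors, and a leaf of a limb
-- vector and a leaf set (`LeafIn`).
data Meet {A B : Set} (R : A → B → Set) : ∀ {m} → Vec A m → Vec B m → Set where
  here  : ∀ {m a b} {u : Vec A m} {v : Vec B m} → R a b → Meet R (a ∷ u) (b ∷ v)
  there : ∀ {m a b} {u : Vec A m} {v : Vec B m} → Meet R u v → Meet R (a ∷ u) (b ∷ v)

Cross : {A B : Set} → (A → B → Set) → ∀ {m} → (Vec A m → Bool) → (Vec B m → Bool) → Set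
Cross R F G = ∀ u v → T (F u) → T (G v) → Meet R u v

BothIn : Bool → Bool → Set
BothIn a b = T a × T b

meet-tail : ∀ {A B : Set} {R : A → B → Set} {m a b} {u : Vec A m} {v : Vec B m} →
  ¬ R a b → Meet R (a ∷ u) (b ∷ v) → Meet R u v
meet-tail ¬r (here r)  = contradiction r ¬r
meet-tail ¬r (there p) = p

sumS : ∀ {m} → (Subset m → ℕ) → ℕ
sumS {zero}  f = f []
sumS {suc m} f = sumS (f ∘ (outside ∷_)) + sumS (f ∘ (inside ∷_))

count : ∀ {m} → Family m → ℕ
count F = sumS (𝟙 ∘ F)

sumS-mono : ∀ {m} {f g : Subset m → ℕ} → (∀ S → f S ≤ g S) → sumS f ≤ sumS g
sumS-mono {zero}  h = h []
sumS-mono {suc m} h = +-mono-≤ (sumS-mono (h ∘ (outside ∷_))) (sumS-mono (h ∘ (inside ∷_)))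

sumS-cong : ∀ {m} {f g : Subset m → ℕ} → (∀ S → f S ≡ g S) → sumS f ≡ sumS g
sumS-cong {zero}  h = h []
sumS-cong {suc m} h = cong₂ _+_ (sumS-cong (h ∘ (outside ∷_))) (sumS-cong (h ∘ (inside ∷_)))

sumS-+ : ∀ {m} (f g : Subset m → ℕ) → sumS (λ S → f S + g S) ≡ sumS f + sumS g
sumS-+ {zero}  f g = refl
sumS-+ {suc m} f g = trans
  (cong₂ _+_ (sumS-+ (f ∘ (outside ∷_)) (g ∘ (outside ∷_)))
             (sumS-+ (f ∘ (inside ∷_)) (g ∘ (inside ∷_))))
  (interchange (sumS (f ∘ (outside ∷_))) _ _ _)

sumS-0 : ∀ m → sumS {m} (λ _ → 0) ≡ 0
sumS-0 zero    = refl
sumS-0 (suc m) = cong₂ _+_ (sumS-0 m) (sumS-0 m)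

sumS-∁ : ∀ {m} (f : Subset m → ℕ) → sumS (f ∘ ∁) ≡ sumS f
sumS-∁ {zero}  f = refl
sumS-∁ {suc m} f = trans
  (cong₂ _+_ (sumS-∁ (f ∘ (inside ∷_))) (sumS-∁ (f ∘ (outside ∷_))))
  (+-comm (sumS (f ∘ (inside ∷_))) _)

count-empty : ∀ {m} {F : Family m} → (∀ S → ¬ T (F S)) → count F ≡ 0
count-empty {m} {F} h = n≤0⇒n≡0 (begin
  count F               ≤⟨ sumS-mono (λ S → 𝟙-mono {F S} {false} (h S)) ⟩
  sumS {m} (λ _ → 0)    ≡⟨ sumS-0 m ⟩
  0                     ∎)
  where open ≤-Reasoning

count-∨-∧ : ∀ {m} (F G : Family m) →
  count (λ S → F S ∨ G S) + count (λ S → F S ∧ G S) ≡ count F + count G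
count-∨-∧ F G = begin
  count (λ S → F S ∨ G S) + count (λ S → F S ∧ G S)  ≡⟨ sumS-+ (λ S → 𝟙 (F S ∨ G S)) _ ⟨
  sumS (λ S → 𝟙 (F S ∨ G S) + 𝟙 (F S ∧ G S))        ≡⟨ sumS-cong (λ S → 𝟙-∨-∧ (F S) (G S)) ⟩
  sumS (λ S → 𝟙 (F S) + 𝟙 (G S))                     ≡⟨ sumS-+ (𝟙 ∘ F) _ ⟩
  count F + count G                                  ∎
  where open ≡-Reasoning

binom : ℕ → ℕ → ℕ
binom _       zero    = 1
binom zero    (suc j) = 0
binom (suc m) (suc j) = binom m j + binom m (suc j)

count-size : ∀ m j → count {m} (λ S → ∣ S ∣ ≡ᵇ j) ≡ binom m j
count-size zero    zero    = refl
count-size zero    (suc j) = refl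
count-size (suc m) zero    = cong₂ _+_ (count-size m zero) (sumS-0 m)
count-size (suc m) (suc j) = trans
  (cong₂ _+_ (count-size m (suc j)) (count-size m j))
  (+-comm (binom m (suc j)) _)

-- The number of `s`-subsets of `m` points through a fixed point, C(m - 1, s - 1), with value 0 if
-- `m` or `s` is 0.
starBound : ℕ → ℕ → ℕ
starBound _       zero    = 0
starBound zero    (suc _) = 0
starBound (suc m) (suc s) = binom m s

-- Pascal's rule one row lower. For `m = s = 0` the left side would be 1 and the right side 0.
starBound-pascal : ∀ {m} s → 0 < m → starBound (suc m) (suc s) ≡ starBound m (suc s) + starBound m s
starBound-pascal {suc m} zero    _ = refl
starBound-pascal {suc m} (suc s) _ = +-comm (binom m s) _

count-star : ∀ {m} s → count {suc m} (λ S → lookup S Fin.zero ∧ (∣ S ∣ ≡ᵇ s)) ≡ starBound (suc m) s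
count-star {m} zero    = cong₂ _+_ (sumS-0 m) (sumS-0 m)
count-star {m} (suc s) = cong₂ _+_ (sumS-0 m) (count-size m s)

∣p∣+∣∁p∣≡n : ∀ {m} (S : Subset m) → ∣ S ∣ + ∣ ∁ S ∣ ≡ m
∣p∣+∣∁p∣≡n []            = refl
∣p∣+∣∁p∣≡n (inside ∷ S)  = cong suc (∣p∣+∣∁p∣≡n S)
∣p∣+∣∁p∣≡n (outside ∷ S) = trans (+-suc ∣ S ∣ _) (cong suc (∣p∣+∣∁p∣≡n S))

¬meet-∁ : ∀ {m} (S : Subset m) → ¬ Meet BothIn (∁ S) S
¬meet-∁ (inside ∷ S)  (here (() , _))
¬meet-∁ (outside ∷ S) (here (_ , ()))
¬meet-∁ (_ ∷ S)       (there p) = ¬meet-∁ S p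

meet-self-size : ∀ {m} (S : Subset m) → Meet BothIn S S → ∣ S ∣ ≢ 0
meet-self-size (inside ∷ S)  _         ()
meet-self-size (outside ∷ S) (there p) eq = meet-self-size S p eq

-- A family on m + 1 points is the pair of its slices: F₀ (members avoiding the
-- first point) and F₁ (members containing it, with the point removed).
-- shift₀ and shift₁ are the slices of the family obtained by replacing the first
-- point by the second wherever the result is new, then by the third, and so on.
shift₀ shift₁ : ∀ {m} → Family m → Family m → Family m
shift₀ F₀ F₁ []            = F₀ []
shift₀ F₀ F₁ (outside ∷ S) =
  shift₀ (F₀ ∘ (outside ∷_)) (λ X → F₀ (inside ∷ X) ∧ F₁ (outside ∷ X)) S
shift₀ F₀ F₁ (inside ∷ S)  =
  shift₀ (λ X → F₀ (inside ∷ X) ∨ F₁ (outside ∷ X)) (F₁ ∘ (inside ∷_)) S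
shift₁ F₀ F₁ []            = F₁ []
shift₁ F₀ F₁ (outside ∷ S) =
  shift₁ (F₀ ∘ (outside ∷_)) (λ X → F₀ (inside ∷ X) ∧ F₁ (outside ∷ X)) S
shift₁ F₀ F₁ (inside ∷ S)  =
  shift₁ (λ X → F₀ (inside ∷ X) ∨ F₁ (outside ∷ X)) (F₁ ∘ (inside ∷_)) S

-- Each trade replaces two families on the remaining points by their union and their intersection,
-- whose sizes have the same sum.
count-shift : ∀ {m} (F₀ F₁ : Family m) →
  count (shift₀ F₀ F₁) + count (shift₁ F₀ F₁) ≡ count F₀ + count F₁
count-shift {zero}  F₀ F₁ = refl
count-shift {suc m} F₀ F₁ = begin
  (count (shift₀ A B) + count (shift₀ C D)) + (count (shift₁ A B) + count (shift₁ C D))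
    ≡⟨ interchange (count (shift₀ A B)) _ _ _ ⟩
  (count (shift₀ A B) + count (shift₁ A B)) + (count (shift₀ C D) + count (shift₁ C D))
    ≡⟨ cong₂ _+_ (count-shift A B) (count-shift C D) ⟩
  (count A + count B) + (count C + count D)
    ≡⟨ +-assoc (count A) _ _ ⟩
  count A + (count B + (count C + count D))
    ≡⟨ cong (count A +_) (+-assoc (count B) _ _) ⟨
  count A + ((count B + count C) + count D)
    ≡⟨ cong (λ z → count A + (z + count D)) (trans (+-comm (count B) _) (count-∨-∧ (F₀ ∘ (inside ∷_)) (F₁ ∘ (outside ∷_)))) ⟩
  count A + ((count (F₀ ∘ (inside ∷_)) + count (F₁ ∘ (outside ∷_))) + count D)
    ≡⟨ cong (count A +_) (+-assoc (count (F₀ ∘ (inside ∷_))) _ _) ⟩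
  count A + (count (F₀ ∘ (inside ∷_)) + (count (F₁ ∘ (outside ∷_)) + count D))
    ≡⟨ +-assoc (count A) _ _ ⟨
  count F₀ + count F₁ ∎
  where
  open ≡-Reasoning
  A = F₀ ∘ (outside ∷_)
  B = λ X → F₀ (inside ∷ X) ∧ F₁ (outside ∷ X)
  C = λ X → F₀ (inside ∷ X) ∨ F₁ (outside ∷ X)
  D = F₁ ∘ (inside ∷_)

-- `P` is a variable so that the induction can pass to `P ∘ suc` on the inside slices.
shift-size : ∀ {m} (P : ℕ → Set) (F₀ F₁ : Family m) →
  (∀ S → T (F₀ S) → P ∣ S ∣) → (∀ S → T (F₁ S) → P (suc ∣ S ∣)) →
  (∀ S → T (shift₀ F₀ F₁ S) → P ∣ S ∣) × (∀ S → T (shift₁ F₀ F₁ S) → P (suc ∣ S ∣))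
shift-size {zero}  P F₀ F₁ h₀ h₁ = (λ { [] → h₀ [] }) , (λ { [] → h₁ [] })
shift-size {suc m} P F₀ F₁ h₀ h₁ = size₀ , size₁
  where
  out = shift-size P (F₀ ∘ (outside ∷_)) (λ X → F₀ (inside ∷ X) ∧ F₁ (outside ∷ X))
    (h₀ ∘ (outside ∷_)) (λ S → h₁ (outside ∷ S) ∘ proj₂ ∘ ∧-T)
  inn = shift-size (P ∘ suc) (λ X → F₀ (inside ∷ X) ∨ F₁ (outside ∷ X)) (F₁ ∘ (inside ∷_))
    (λ S → [ h₀ (inside ∷ S) , h₁ (outside ∷ S) ]′ ∘ ∨-T) (h₁ ∘ (inside ∷_))
  size₀ : ∀ S → T (shift₀ F₀ F₁ S) → P ∣ S ∣
  size₀ (outside ∷ S) = proj₁ out S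
  size₀ (inside ∷ S)  = proj₁ inn S
  size₁ : ∀ S → T (shift₁ F₀ F₁ S) → P (suc ∣ S ∣)
  size₁ (outside ∷ S) = proj₂ out S
  size₁ (inside ∷ S)  = proj₂ inn S

-- The families with slices F₀, F₁ and G₀, G₁ are cross-intersecting exactly when
-- this holds, since members of F₁ and G₁ share the first point.
record SlicesCross {m} (F₀ F₁ G₀ G₁ : Family m) : Set where
  constructor slicesCross
  field
    c₀₀ : Cross BothIn F₀ G₀
    c₀₁ : Cross BothIn F₀ G₁
    c₁₀ : Cross BothIn F₁ G₀

module _ {m} (F₀ F₁ G₀ G₁ : Family (suc m)) where
  private
    out-in : ∀ {F G : Family (suc m)} → Cross BothIn F G →
      Cross BothIn (F ∘ (outside ∷_)) (G ∘ (inside ∷_))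
    out-in c X Y f g = meet-tail proj₁ (c _ _ f g)
    in-out : ∀ {F G : Family (suc m)} → Cross BothIn F G →
      Cross BothIn (F ∘ (inside ∷_)) (G ∘ (outside ∷_))
    in-out c X Y f g = meet-tail proj₂ (c _ _ f g)
    out-out : ∀ {F G : Family (suc m)} → Cross BothIn F G →
      Cross BothIn (F ∘ (outside ∷_)) (G ∘ (outside ∷_))
    out-out c X Y f g = meet-tail proj₁ (c _ _ f g)

  module Slice (c : SlicesCross F₀ F₁ G₀ G₁) where
    open SlicesCross c

    slice-out-out : SlicesCross
      (F₀ ∘ (outside ∷_)) (λ X → F₀ (inside ∷ X) ∧ F₁ (outside ∷ X))
      (G₀ ∘ (outside ∷_)) (λ X → G₀ (inside ∷ X) ∧ G₁ (outside ∷ X))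
    slice-out-out = slicesCross
      (out-out c₀₀)
      (λ X Y f g → out-out c₀₁ X Y f (proj₂ (∧-T g)))
      (λ X Y f g → out-out c₁₀ X Y (proj₂ (∧-T f)) g)

    -- A set that keeps the first point although it lacks the second does so because its traded copy
    -- was present already. The copy of X with the second point must meet Y with the first point, so
    -- X and Y share a later point.
    slice-out-out₁₁ : Cross BothIn
      (λ X → F₀ (inside ∷ X) ∧ F₁ (outside ∷ X)) (λ X → G₀ (inside ∷ X) ∧ G₁ (outside ∷ X))
    slice-out-out₁₁ X Y f g = in-out c₀₁ X Y (proj₁ (∧-T f)) (proj₂ (∧-T g))

    slice-out-in : SlicesCross
      (F₀ ∘ (outside ∷_)) (λ X → F₀ (inside ∷ X) ∧ F₁ (outside ∷ X))
      (λ X → G₀ (inside ∷ X) ∨ G₁ (outside ∷ X)) (G₁ ∘ (inside ∷_))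
    slice-out-in = slicesCross
      (λ X Y f g → [ out-in c₀₀ X Y f , out-out c₀₁ X Y f ]′ (∨-T g))
      (out-in c₀₁)
      -- Both versions of X are available, with the first point or with the second. The one that
      -- shares neither of these points with the given version of Y is chosen.
      (λ X Y f g → let f₀ , f₁ = ∧-T f in
        [ out-in c₁₀ X Y f₁ , in-out c₀₁ X Y f₀ ]′ (∨-T g))

    slice-in-out : SlicesCross
      (λ X → F₀ (inside ∷ X) ∨ F₁ (outside ∷ X)) (F₁ ∘ (inside ∷_))
      (G₀ ∘ (outside ∷_)) (λ X → G₀ (inside ∷ X) ∧ G₁ (outside ∷ X))
    slice-in-out = slicesCross
      (λ X Y f g → [ (λ f → in-out c₀₀ X Y f g) , (λ f → out-out c₁₀ X Y f g) ]′ (∨-T f))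
      (λ X Y f g → let g₀ , g₁ = ∧-T g in
        [ (λ f → in-out c₀₁ X Y f g₁) , (λ f → out-in c₁₀ X Y f g₀) ]′ (∨-T f))
      (in-out c₁₀)

    slice-out-in₁₁ : Cross BothIn F₁ G₁ → Cross BothIn
      (λ X → F₀ (inside ∷ X) ∧ F₁ (outside ∷ X)) (G₁ ∘ (inside ∷_))
    slice-out-in₁₁ c₁₁ X Y f = out-in c₁₁ X Y (proj₂ (∧-T f))

    slice-in-out₁₁ : Cross BothIn F₁ G₁ → Cross BothIn
      (F₁ ∘ (inside ∷_)) (λ X → G₀ (inside ∷ X) ∧ G₁ (outside ∷ X))
    slice-in-out₁₁ c₁₁ X Y f g = in-out c₁₁ X Y f (proj₂ (∧-T g))

-- Two inside branches meet at once; in the three other cases the slices after the trade are again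
-- cross-intersecting, and the induction goes on.
shift₀-cross : ∀ {m} (F₀ F₁ G₀ G₁ : Family m) → SlicesCross F₀ F₁ G₀ G₁ →
  Cross BothIn (shift₀ F₀ F₁) (shift₀ G₀ G₁)
shift₀-cross F₀ F₁ G₀ G₁ c [] [] = SlicesCross.c₀₀ c [] []
shift₀-cross F₀ F₁ G₀ G₁ c (inside ∷ X)  (inside ∷ Y)  _ _ = here (tt , tt)
shift₀-cross F₀ F₁ G₀ G₁ c (inside ∷ X)  (outside ∷ Y) f g =
  there (shift₀-cross _ _ _ _ (Slice.slice-in-out F₀ F₁ G₀ G₁ c) X Y f g)
shift₀-cross F₀ F₁ G₀ G₁ c (outside ∷ X) (inside ∷ Y)  f g =
  there (shift₀-cross _ _ _ _ (Slice.slice-out-in F₀ F₁ G₀ G₁ c) X Y f g)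
shift₀-cross F₀ F₁ G₀ G₁ c (outside ∷ X) (outside ∷ Y) f g =
  there (shift₀-cross _ _ _ _ (Slice.slice-out-out F₀ F₁ G₀ G₁ c) X Y f g)

-- This serves the situation after an uncovered point, where `slice-out-out₁₁` makes the members
-- through the first point meet elsewhere as well; shifting preserves this.
shift₁-cross : ∀ {m} (F₀ F₁ G₀ G₁ : Family m) → SlicesCross F₀ F₁ G₀ G₁ →
  Cross BothIn F₁ G₁ → Cross BothIn (shift₁ F₀ F₁) (shift₁ G₀ G₁)
shift₁-cross F₀ F₁ G₀ G₁ c c₁₁ [] [] = c₁₁ [] []
shift₁-cross F₀ F₁ G₀ G₁ c c₁₁ (inside ∷ X)  (inside ∷ Y)  _ _ = here (tt , tt)
shift₁-cross F₀ F₁ G₀ G₁ c c₁₁ (inside ∷ X)  (outside ∷ Y) f g =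
  there (shift₁-cross _ _ _ _ (S.slice-in-out) (S.slice-in-out₁₁ c₁₁) X Y f g)
  where module S = Slice F₀ F₁ G₀ G₁ c
shift₁-cross F₀ F₁ G₀ G₁ c c₁₁ (outside ∷ X) (inside ∷ Y)  f g =
  there (shift₁-cross _ _ _ _ (S.slice-out-in) (S.slice-out-in₁₁ c₁₁) X Y f g)
  where module S = Slice F₀ F₁ G₀ G₁ c
shift₁-cross F₀ F₁ G₀ G₁ c c₁₁ (outside ∷ X) (outside ∷ Y) f g =
  there (shift₁-cross _ _ _ _ (S.slice-out-out) (S.slice-out-out₁₁) X Y f g)
  where module S = Slice F₀ F₁ G₀ G₁ c

-- Two shifted members sharing only the first point leave no point uncovered:
-- otherwise one of them could trade the first point for an uncovered one.
shift₁-meet-or-cover : ∀ {m} (F₀ F₁ G₀ G₁ : Family m) → SlicesCross F₀ F₁ G₀ G₁ →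
  ∀ X Y → T (shift₁ F₀ F₁ X) → T (shift₁ G₀ G₁ Y) → Meet BothIn X Y ⊎ m ≤ ∣ X ∣ + ∣ Y ∣
shift₁-meet-or-cover F₀ F₁ G₀ G₁ c [] [] _ _ = inj₂ z≤n
shift₁-meet-or-cover F₀ F₁ G₀ G₁ c (inside ∷ X)  (inside ∷ Y)  _ _ = inj₁ (here (tt , tt))
shift₁-meet-or-cover F₀ F₁ G₀ G₁ c (inside ∷ X)  (outside ∷ Y) f g =
  Sum.map there s≤s (shift₁-meet-or-cover _ _ _ _ (Slice.slice-in-out F₀ F₁ G₀ G₁ c) X Y f g)
shift₁-meet-or-cover {suc m} F₀ F₁ G₀ G₁ c (outside ∷ X) (inside ∷ Y)  f g =
  Sum.map there (subst (suc m ≤_) (sym (+-suc ∣ X ∣ ∣ Y ∣)) ∘ s≤s)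
    (shift₁-meet-or-cover _ _ _ _ (Slice.slice-out-in F₀ F₁ G₀ G₁ c) X Y f g)
shift₁-meet-or-cover F₀ F₁ G₀ G₁ c (outside ∷ X) (outside ∷ Y) f g =
  inj₁ (there (shift₁-cross _ _ _ _ S.slice-out-out S.slice-out-out₁₁ X Y f g))
  where module S = Slice F₀ F₁ G₀ G₁ c

-- Induction on the number of points. If it exceeds twice the set size, the first point is shifted
-- away: both slices are then intersecting, because two members through that point are too small to
-- cover all others. In the case of equality, sets are paired with their complements.
ekr : ∀ m r → 2 * r ≤ m → (F : Family m) → (∀ S → T (F S) → ∣ S ∣ ≡ r) →
  Cross BothIn F F → count F ≤ starBound m r
ekr m zero _ F size meet = ≤-reflexive (count-empty λ S f → meet-self-size S (meet S S f f) (size S f))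
ekr (suc m) (suc r) 2r≤m F size meet with m≤n⇒m<n∨m≡n 2r≤m
... | inj₁ (s≤s 2r≤m′) = begin
  count F₀ + count F₁                            ≡⟨ count-shift F₀ F₁ ⟨
  count (shift₀ F₀ F₁) + count (shift₁ F₀ F₁)    ≤⟨ +-mono-≤ avoiding containing ⟩
  starBound m (suc r) + starBound m r            ≡⟨ starBound-pascal r (≤-trans (s≤s z≤n) 2r≤m′) ⟨
  starBound (suc m) (suc r)                      ∎
  where
  open ≤-Reasoning
  F₀ = F ∘ (outside ∷_)
  F₁ = F ∘ (inside ∷_)
  slices : SlicesCross F₀ F₁ F₀ F₁
  slices = slicesCross
    (λ X Y f g → meet-tail proj₁ (meet _ _ f g))
    (λ X Y f g → meet-tail proj₁ (meet _ _ f g))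
    (λ X Y f g → meet-tail proj₂ (meet _ _ f g))
  sizes = shift-size (_≡ suc r) F₀ F₁ (size ∘ (outside ∷_)) (size ∘ (inside ∷_))
  size₁ : ∀ X → T (shift₁ F₀ F₁ X) → ∣ X ∣ ≡ r
  size₁ X = suc-injective ∘ proj₂ sizes X
  2r<m : 2 * r < m
  2r<m = ≤-trans (s≤s (+-monoʳ-≤ r (n≤1+n (r + 0)))) 2r≤m′
  avoiding : count (shift₀ F₀ F₁) ≤ starBound m (suc r)
  avoiding = ekr m (suc r) 2r≤m′ (shift₀ F₀ F₁) (proj₁ sizes) (shift₀-cross F₀ F₁ F₀ F₁ slices)
  containing : count (shift₁ F₀ F₁) ≤ starBound m r
  containing = ekr m r (<⇒≤ 2r<m) (shift₁ F₀ F₁) size₁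
    λ X Y f g → case shift₁-meet-or-cover F₀ F₁ F₀ F₁ slices X Y f g of λ where
      (inj₁ p)     → p
      (inj₂ cover) → contradiction
        (subst₂ (λ a b → m ≤ a + b) (size₁ X f) (trans (size₁ Y g) (sym (+-identityʳ r))) cover)
        (<⇒≱ 2r<m)
-- A member avoiding the first point is indexed by its complement with that point removed. At most
-- one set of each complementary pair is a member, and the pairs correspond to the `r`-subsets of
-- the other `m` points.
... | inj₂ 2r≡m = begin
  count F₀ + count F₁                          ≡⟨ cong (_+ count F₁) (sumS-∁ (𝟙 ∘ F₀)) ⟨
  count (F₀ ∘ ∁) + count F₁                    ≡⟨ sumS-+ (𝟙 ∘ F₀ ∘ ∁) (𝟙 ∘ F₁) ⟨
  sumS (λ S → 𝟙 (F₀ (∁ S)) + 𝟙 (F₁ S))         ≤⟨ sumS-mono (λ S → 𝟙-disjoint (size₀ S) (size₁ S) (disjoint S)) ⟩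
  count {m} (λ S → ∣ S ∣ ≡ᵇ r)                 ≡⟨ count-size m r ⟩
  binom m r                                    ∎
  where
  open ≤-Reasoning
  F₀ = F ∘ (outside ∷_)
  F₁ = F ∘ (inside ∷_)
  size₁ : ∀ S → T (F₁ S) → T (∣ S ∣ ≡ᵇ r)
  size₁ S f = ≡⇒≡ᵇ ∣ S ∣ r (suc-injective (size _ f))
  size₀ : ∀ S → T (F₀ (∁ S)) → T (∣ S ∣ ≡ᵇ r)
  size₀ S f = ≡⇒≡ᵇ ∣ S ∣ r (+-cancelʳ-≡ (suc r) ∣ S ∣ r (begin-equality
    ∣ S ∣ + suc r       ≡⟨ cong (∣ S ∣ +_) (size _ f) ⟨
    ∣ S ∣ + ∣ ∁ S ∣     ≡⟨ ∣p∣+∣∁p∣≡n S ⟩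
    m                   ≡⟨ suc-injective 2r≡m ⟨
    r + (suc r + 0)     ≡⟨ cong (r +_) (+-identityʳ (suc r)) ⟩
    r + suc r           ∎))
  disjoint : ∀ S → T (F₀ (∁ S)) → ¬ T (F₁ S)
  disjoint S f g = ¬meet-∁ S (meet-tail proj₁ (meet _ _ f g))

-- Compression of families on limbs

count-∃ : ∀ {m} (F : Family m) → count F ≢ 0 → ∃[ S ] T (F S)
count-∃ {zero}  F c with F [] in eq
... | true  = [] , subst T (sym eq) tt
... | false = contradiction refl c
count-∃ {suc m} F c with count (F ∘ (outside ∷_)) ≟ 0
... | no  c₀ = let S , f = count-∃ _ c₀ in outside ∷ S , f
... | yes c₀ = let S , f = count-∃ _ (c ∘ cong₂ _+_ c₀) in inside ∷ S , f

+-squeeze : ∀ {a b c d} → a ≤ b → c ≤ d → b + d ≤ a + c → b ≤ a × d ≤ c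
+-squeeze {a} {b} {c} {d} a≤b c≤d sum =
    +-cancelʳ-≤ d b a (≤-trans sum (+-monoʳ-≤ a c≤d))
  , +-cancelˡ-≤ b d c (≤-trans sum (+-monoˡ-≤ c a≤b))

count-full : ∀ {m} {F G : Family m} → (∀ S → T (F S) → T (G S)) → count G ≤ count F →
  ∀ S → T (G S) → T (F S)
count-full {F = F} {G} F⊆G G≤F [] g with F [] | G []
... | true  | _    = tt
... | false | true = contradiction G≤F λ ()
count-full {F = F} {G} F⊆G G≤F (b ∷ S) g = split b g
  where
  halves = +-squeeze (sumS-mono (λ S → 𝟙-mono (F⊆G (outside ∷ S))))
                     (sumS-mono (λ S → 𝟙-mono (F⊆G (inside ∷ S)))) G≤F
  split : ∀ b → T (G (b ∷ S)) → T (F (b ∷ S))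
  split outside = count-full (F⊆G ∘ (outside ∷_)) (proj₁ halves) S
  split inside  = count-full (F⊆G ∘ (inside ∷_)) (proj₂ halves) S

sumTo : ℕ → (ℕ → ℕ) → ℕ
sumTo zero    h = 0
sumTo (suc N) h = sumTo N h + h N

sumTo-mono : ∀ N {h g : ℕ → ℕ} → (∀ s → s < N → h s ≤ g s) → sumTo N h ≤ sumTo N g
sumTo-mono zero    le = z≤n
sumTo-mono (suc N) le = +-mono-≤ (sumTo-mono N (λ s → le s ∘ m<n⇒m<1+n)) (le N ≤-refl)

sumTo-strict : ∀ {j} N {h g : ℕ → ℕ} → (∀ s → s < N → h s ≤ g s) → j < N → h j < g j →
  sumTo N h < sumTo N g
sumTo-strict (suc N) le (s≤s j≤N) lt with m≤n⇒m<n∨m≡n j≤N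
... | inj₁ j<N  = +-mono-<-≤ (sumTo-strict N (λ s → le s ∘ m<n⇒m<1+n) j<N lt) (le N ≤-refl)
... | inj₂ refl = +-mono-≤-< (sumTo-mono N (λ s → le s ∘ m<n⇒m<1+n)) lt

sumTo-cong : ∀ N {h g : ℕ → ℕ} → (∀ s → h s ≡ g s) → sumTo N h ≡ sumTo N g
sumTo-cong zero    eq = refl
sumTo-cong (suc N) eq = cong₂ _+_ (sumTo-cong N eq) (eq N)

sumS-sumTo : ∀ {m} N (a : Subset m → ℕ → ℕ) →
  sumS (λ S → sumTo N (a S)) ≡ sumTo N (λ s → sumS (λ S → a S s))
sumS-sumTo {m} zero a = sumS-0 m
sumS-sumTo (suc N)  a = trans (sumS-+ (λ S → sumTo N (a S)) _)
  (cong (_+ sumS (λ S → a S N)) (sumS-sumTo N a))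

sumS-*ʳ : ∀ {m} (f : Subset m → ℕ) c → sumS (λ S → f S * c) ≡ sumS f * c
sumS-*ʳ {zero}  f c = refl
sumS-*ʳ {suc m} f c = trans (cong₂ _+_ (sumS-*ʳ (f ∘ (outside ∷_)) c) (sumS-*ʳ (f ∘ (inside ∷_)) c))
  (sym (*-distribʳ-+ c (sumS (f ∘ (outside ∷_))) _))

≡ᵇ-refl : ∀ n → (n ≡ᵇ n) ≡ true
≡ᵇ-refl zero    = refl
≡ᵇ-refl (suc n) = ≡ᵇ-refl n

≢⇒≡ᵇ-false : ∀ m n → m ≢ n → (m ≡ᵇ n) ≡ false
≢⇒≡ᵇ-false m n m≢n with m ≡ᵇ n in eq
... | true  = contradiction (≡ᵇ⇒≡ m n (subst T (sym eq) tt)) m≢n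
... | false = refl

sumTo-delta-≥ : ∀ N (w : ℕ → ℕ) t → N ≤ t → sumTo N (λ s → 𝟙 (t ≡ᵇ s) * w s) ≡ 0
sumTo-delta-≥ zero    w t N≤t = refl
sumTo-delta-≥ (suc N) w t N<t = cong₂ _+_ (sumTo-delta-≥ N w t (<⇒≤ N<t))
  (cong (λ b → 𝟙 b * w N) (≢⇒≡ᵇ-false t N (<⇒≢ N<t ∘ sym)))

sumTo-delta-< : ∀ N (w : ℕ → ℕ) t → t < N → sumTo N (λ s → 𝟙 (t ≡ᵇ s) * w s) ≡ w t
sumTo-delta-< (suc N) w t (s≤s t≤N) with m≤n⇒m<n∨m≡n t≤N
... | inj₁ t<N = trans (cong₂ _+_ (sumTo-delta-< N w t t<N)
                          (cong (λ b → 𝟙 b * w N) (≢⇒≡ᵇ-false t N (<⇒≢ t<N))))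
                        (+-identityʳ (w t))
... | inj₂ refl = cong₂ _+_ (sumTo-delta-≥ N w N ≤-refl)
                    (trans (cong (λ b → 𝟙 b * w N) (≡ᵇ-refl N)) (+-identityʳ (w N)))

level : ∀ {m} → Family m → ℕ → Family m
level F s S = F S ∧ (∣ S ∣ ≡ᵇ s)

-- Sets are grouped by size; those of size at least `N` drop out because their weight vanishes.
sumS-levels : ∀ {m} N (F : Family m) (w : ℕ → ℕ) → (∀ t → N ≤ t → w t ≡ 0) →
  sumS (λ S → 𝟙 (F S) * w ∣ S ∣) ≡ sumTo N (λ s → count (level F s) * w s)
sumS-levels N F w vanish = begin
  sumS (λ S → 𝟙 (F S) * w ∣ S ∣)
    ≡⟨ sumS-cong (λ S → pointwise (F S) ∣ S ∣) ⟩
  sumS (λ S → sumTo N (λ s → 𝟙 (level F s S) * w s))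
    ≡⟨ sumS-sumTo N (λ S s → 𝟙 (level F s S) * w s) ⟩
  sumTo N (λ s → sumS (λ S → 𝟙 (level F s S) * w s))
    ≡⟨ sumTo-cong N (λ s → sumS-*ʳ (𝟙 ∘ level F s) (w s)) ⟩
  sumTo N (λ s → count (level F s) * w s) ∎
  where
  open ≡-Reasoning
  sumTo-0 : ∀ M → 0 ≡ sumTo M (λ _ → 0)
  sumTo-0 zero    = refl
  sumTo-0 (suc M) = cong (_+ 0) (sumTo-0 M)
  pointwise : ∀ b t → 𝟙 b * w t ≡ sumTo N (λ s → 𝟙 (b ∧ (t ≡ᵇ s)) * w s)
  pointwise false t = sumTo-0 N
  pointwise true  t with t <? N
  ... | yes t<N = trans (+-identityʳ (w t)) (sym (sumTo-delta-< N w t t<N))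
  ... | no  t≮N = trans (+-identityʳ (w t))
    (trans (vanish t (≮⇒≥ t≮N)) (sym (sumTo-delta-≥ N w t (≮⇒≥ t≮N))))

-- The trace on a limb of an independent set avoiding the root.
data Limb : Set where
  none inner leaf : Limb

isLeaf : Limb → Bool
isLeaf leaf = true
isLeaf _    = false

leaves : ∀ {k} → Vec Limb k → Subset k
leaves = map isLeaf

wt : ∀ {k} → Vec Limb k → ℕ
wt []          = 0
wt (none ∷ U)  = wt U
wt (inner ∷ U) = suc (wt U)
wt (leaf ∷ U)  = suc (wt U)

LimbFamily : ℕ → Set
LimbFamily k = Vec Limb k → Bool

data Common : Limb → Limb → Set where
  inners : Common inner inner
  leafs  : Common leaf leaf

BothLeaf : Limb → Limb → Set
BothLeaf x y = T (isLeaf x) × T (isLeaf y)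

LeafIn : Limb → Bool → Set
LeafIn x b = T (isLeaf x) × T b

sumL : ∀ {k} → (Vec Limb k → ℕ) → ℕ
sumL {zero}  f = f []
sumL {suc k} f = sumL (f ∘ (none ∷_)) + (sumL (f ∘ (inner ∷_)) + sumL (f ∘ (leaf ∷_)))

countL : ∀ {k} → LimbFamily k → ℕ
countL F = sumL (𝟙 ∘ F)

sumL-mono : ∀ {k} {f g : Vec Limb k → ℕ} → (∀ U → f U ≤ g U) → sumL f ≤ sumL g
sumL-mono {zero}  h = h []
sumL-mono {suc k} h = +-mono-≤ (sumL-mono (h ∘ (none ∷_)))
  (+-mono-≤ (sumL-mono (h ∘ (inner ∷_))) (sumL-mono (h ∘ (leaf ∷_))))

countL-empty : ∀ {k} {F : LimbFamily k} → (∀ U → ¬ T (F U)) → countL F ≡ 0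
countL-empty {zero} {F} h with F [] | h []
... | true  | ¬t = contradiction tt ¬t
... | false | _  = refl
countL-empty {suc k} h = cong₂ _+_ (countL-empty (h ∘ (none ∷_)))
  (cong₂ _+_ (countL-empty (h ∘ (inner ∷_))) (countL-empty (h ∘ (leaf ∷_))))

countL-∧-∨ : ∀ {k} (F G : LimbFamily k) →
  countL (λ U → F U ∧ G U) + countL (λ U → F U ∨ G U) ≡ countL F + countL G
countL-∧-∨ {zero}  F G = trans (+-comm (𝟙 (F [] ∧ G [])) _) (𝟙-∨-∧ (F []) (G []))
countL-∧-∨ {suc k} F G = begin
  (n∧ + (i∧ + l∧)) + (n∨ + (i∨ + l∨))   ≡⟨ interchange n∧ _ _ _ ⟩
  (n∧ + n∨) + ((i∧ + l∧) + (i∨ + l∨))   ≡⟨ cong ((n∧ + n∨) +_) (interchange i∧ _ _ _) ⟩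
  (n∧ + n∨) + ((i∧ + i∨) + (l∧ + l∨))   ≡⟨ cong₂ _+_ (rec none) (cong₂ _+_ (rec inner) (rec leaf)) ⟩
  (c F none + c G none) + ((c F inner + c G inner) + (c F leaf + c G leaf))
    ≡⟨ cong ((c F none + c G none) +_) (interchange (c F inner) _ _ _) ⟩
  (c F none + c G none) + ((c F inner + c F leaf) + (c G inner + c G leaf))
    ≡⟨ interchange (c F none) _ _ _ ⟩
  countL F + countL G ∎
  where
  open ≡-Reasoning
  c : LimbFamily (suc k) → Limb → ℕ
  c E x = countL (E ∘ (x ∷_))
  n∧ = c (λ U → F U ∧ G U) none
  i∧ = c (λ U → F U ∧ G U) inner
  l∧ = c (λ U → F U ∧ G U) leaf
  n∨ = c (λ U → F U ∨ G U) none
  i∨ = c (λ U → F U ∨ G U) inner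
  l∨ = c (λ U → F U ∨ G U) leaf
  rec : ∀ x → c (λ U → F U ∧ G U) x + c (λ U → F U ∨ G U) x ≡ c F x + c G x
  rec x = countL-∧-∨ (F ∘ (x ∷_)) (G ∘ (x ∷_))

-- Replaces the inner vertex of a limb by its leaf wherever the result is new,
-- one limb after the other.
compress : ∀ {k} → LimbFamily k → LimbFamily k
compress F []          = F []
compress F (none ∷ U)  = compress (F ∘ (none ∷_)) U
compress F (inner ∷ U) = compress (λ V → F (inner ∷ V) ∧ F (leaf ∷ V)) U
compress F (leaf ∷ U)  = compress (λ V → F (inner ∷ V) ∨ F (leaf ∷ V)) U

countL-compress : ∀ {k} (F : LimbFamily k) → countL (compress F) ≡ countL F
countL-compress {zero}  F = refl
countL-compress {suc k} F = cong₂ _+_ (countL-compress (F ∘ (none ∷_)))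
  (trans (cong₂ _+_ (countL-compress (λ V → F (inner ∷ V) ∧ F (leaf ∷ V)))
                    (countL-compress (λ V → F (inner ∷ V) ∨ F (leaf ∷ V))))
         (countL-∧-∨ (F ∘ (inner ∷_)) (F ∘ (leaf ∷_))))

compress-wt : ∀ {k} (P : ℕ → Set) (F : LimbFamily k) → (∀ U → T (F U) → P (wt U)) →
  ∀ U → T (compress F U) → P (wt U)
compress-wt P F h []          f = h [] f
compress-wt P F h (none ∷ U)  f = compress-wt P _ (h ∘ (none ∷_)) U f
compress-wt P F h (inner ∷ U) f =
  compress-wt (P ∘ suc) (λ V → F (inner ∷ V) ∧ F (leaf ∷ V)) (λ V → h (leaf ∷ V) ∘ proj₂ ∘ ∧-T) U f
compress-wt P F h (leaf ∷ U)  f =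
  compress-wt (P ∘ suc) (λ V → F (inner ∷ V) ∨ F (leaf ∷ V))
    (λ V → [ h (inner ∷ V) , h (leaf ∷ V) ]′ ∘ ∨-T) U f

-- An inner vertex survives compression only if the version with the leaf is present too. So on a
-- limb without a common leaf after compression, original versions of the two members can be chosen
-- that share nothing there, and they must meet on a later limb.
compress-cross : ∀ {k} (F G : LimbFamily k) → Cross Common F G →
  Cross BothLeaf (compress F) (compress G)
compress-cross F G c [] [] f g = case c [] [] f g of λ ()
compress-cross F G c (leaf ∷ U) (leaf ∷ V) f g = here (tt , tt)
compress-cross F G c (none ∷ U) (none ∷ V) f g = there (compress-cross _ _
  (λ X Y f g → meet-tail (λ ()) (c _ _ f g)) U V f g)
compress-cross F G c (none ∷ U) (inner ∷ V) f g = there (compress-cross _ _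
  (λ X Y f g → meet-tail (λ ()) (c _ _ f (proj₁ (∧-T g)))) U V f g)
compress-cross F G c (none ∷ U) (leaf ∷ V) f g = there (compress-cross _ _
  (λ X Y f g → [ (λ g → meet-tail (λ ()) (c _ _ f g)) , (λ g → meet-tail (λ ()) (c _ _ f g)) ]′ (∨-T g)) U V f g)
compress-cross F G c (inner ∷ U) (none ∷ V) f g = there (compress-cross _ _
  (λ X Y f g → meet-tail (λ ()) (c _ _ (proj₁ (∧-T f)) g)) U V f g)
compress-cross F G c (leaf ∷ U) (none ∷ V) f g = there (compress-cross _ _
  (λ X Y f g → [ (λ f → meet-tail (λ ()) (c _ _ f g)) , (λ f → meet-tail (λ ()) (c _ _ f g)) ]′ (∨-T f)) U V f g)
compress-cross F G c (inner ∷ U) (inner ∷ V) f g = there (compress-cross _ _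
  (λ X Y f g → meet-tail (λ ()) (c _ _ (proj₁ (∧-T f)) (proj₂ (∧-T g)))) U V f g)
compress-cross F G c (inner ∷ U) (leaf ∷ V) f g = there (compress-cross _ _
  (λ X Y f g → [ (λ g → meet-tail (λ ()) (c _ _ (proj₂ (∧-T f)) g))
               , (λ g → meet-tail (λ ()) (c _ _ (proj₁ (∧-T f)) g)) ]′ (∨-T g)) U V f g)
compress-cross F G c (leaf ∷ U) (inner ∷ V) f g = there (compress-cross _ _
  (λ X Y f g → [ (λ f → meet-tail (λ ()) (c _ _ f (proj₂ (∧-T g))))
               , (λ f → meet-tail (λ ()) (c _ _ f (proj₁ (∧-T g)))) ]′ (∨-T f)) U V f g)

-- On a limb where no leaf is shared after compression, `F` contains a version of the member that
-- shares no leaf there either, so the common leaf lies on a later limb.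
compress-crossˡ : ∀ {k} (F : LimbFamily k) (H : Family k) → Cross LeafIn F H →
  Cross LeafIn (compress F) H
compress-crossˡ F H c [] [] f h = c [] [] f h
compress-crossˡ F H c (leaf ∷ U) (inside ∷ S) f h = here (tt , tt)
compress-crossˡ F H c (none ∷ U) (b ∷ S) f h = there (compress-crossˡ _ _
  (λ X Y f h → meet-tail proj₁ (c _ _ f h)) U S f h)
compress-crossˡ F H c (inner ∷ U) (b ∷ S) f h = there (compress-crossˡ _ _
  (λ X Y f h → meet-tail proj₁ (c _ _ (proj₁ (∧-T f)) h)) U S f h)
compress-crossˡ F H c (leaf ∷ U) (outside ∷ S) f h = there (compress-crossˡ _ _
  (λ X Y f h → [ (λ f → meet-tail proj₂ (c _ _ f h)) , (λ f → meet-tail proj₂ (c _ _ f h)) ]′ (∨-T f)) U S f h)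

-- The witness is `U` with every inner vertex moved to its leaf; the unions formed at the leaves
-- always keep it. Limbs that `U` misses stay empty.
compress-lift : ∀ {k} (F : LimbFamily k) U → T (F U) →
  ∃[ V ] T (compress F V) × (∀ i → T (isLeaf (lookup V i)) → lookup U i ≢ none)
compress-lift F [] f = [] , f , λ ()
compress-lift F (none ∷ U) f with compress-lift (F ∘ (none ∷_)) U f
... | V , g , h = none ∷ V , g , λ { Fin.zero () ; (Fin.suc i) → h i }
compress-lift F (inner ∷ U) f
  with compress-lift (λ V → F (inner ∷ V) ∨ F (leaf ∷ V)) U (T-∨-intro (inj₁ f))
... | V , g , h = leaf ∷ V , g , λ { Fin.zero _ () ; (Fin.suc i) → h i }
compress-lift F (leaf ∷ U) f
  with compress-lift (λ V → F (inner ∷ V) ∨ F (leaf ∷ V)) U (T-∨-intro {F (inner ∷ U)} (inj₂ f))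
... | V , g , h = leaf ∷ V , g , λ { Fin.zero _ () ; (Fin.suc i) → h i }

-- Leaf sets and the number of their extensions

trace : ∀ {k} → LimbFamily k → Family k
trace F []            = F []
trace F (outside ∷ S) = trace (F ∘ (none ∷_)) S ∨ trace (F ∘ (inner ∷_)) S
trace F (inside ∷ S)  = trace (F ∘ (leaf ∷_)) S

trace-complete : ∀ {k} (F : LimbFamily k) U → T (F U) → T (trace F (leaves U))
trace-complete F []          f = f
trace-complete F (none ∷ U)  f = T-∨-intro (inj₁ (trace-complete (F ∘ (none ∷_)) U f))
trace-complete F (inner ∷ U) f = T-∨-intro {trace (F ∘ (none ∷_)) (leaves U)}
  (inj₂ (trace-complete (F ∘ (inner ∷_)) U f))
trace-complete F (leaf ∷ U)  f = trace-complete (F ∘ (leaf ∷_)) U f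

trace-sound : ∀ {k} (F : LimbFamily k) S → T (trace F S) → ∃[ U ] T (F U) × leaves U ≡ S
trace-sound F []            f = [] , f , refl
trace-sound F (inside ∷ S)  f with trace-sound (F ∘ (leaf ∷_)) S f
... | U , g , eq = leaf ∷ U , g , cong (inside ∷_) eq
trace-sound F (outside ∷ S) f with ∨-T {trace (F ∘ (none ∷_)) S} f
... | inj₁ f′ = let U , g , eq = trace-sound (F ∘ (none ∷_)) S f′ in none ∷ U , g , cong (outside ∷_) eq
... | inj₂ f′ = let U , g , eq = trace-sound (F ∘ (inner ∷_)) S f′ in inner ∷ U , g , cong (outside ∷_) eq

-- The number of U of weight r with leaves U ≡ S.
extensions : ∀ {k} → Subset k → ℕ → ℕ
extensions []            zero    = 1
extensions []            (suc r) = 0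
extensions (outside ∷ S) zero    = extensions S zero
extensions (outside ∷ S) (suc r) = extensions S (suc r) + extensions S r
extensions (inside ∷ S)  zero    = 0
extensions (inside ∷ S)  (suc r) = extensions S r

countL-leaves : ∀ {k} (h : Family k) r →
  countL (λ U → h (leaves U) ∧ (wt U ≡ᵇ r)) ≡ sumS (λ S → 𝟙 (h S) * extensions S r)
countL-leaves {zero} h zero with h []
... | true  = refl
... | false = refl
countL-leaves {zero} h (suc r) with h []
... | true  = refl
... | false = refl
countL-leaves {suc k} h zero = begin
  countL (λ U → h (outside ∷ leaves U) ∧ (wt U ≡ᵇ 0))
    + (countL (λ U → h (outside ∷ leaves U) ∧ false) + countL (λ U → h (inside ∷ leaves U) ∧ false))
    ≡⟨ cong₂ _+_ (countL-leaves (h ∘ (outside ∷_)) zero)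
         (cong₂ _+_ (countL-empty {k} (λ U → proj₂ ∘ ∧-T {h (outside ∷ leaves U)}))
                    (countL-empty {k} (λ U → proj₂ ∘ ∧-T {h (inside ∷ leaves U)}))) ⟩
  sumS (λ S → 𝟙 (h (outside ∷ S)) * extensions S 0) + 0
    ≡⟨ cong (sumS (λ S → 𝟙 (h (outside ∷ S)) * extensions S 0) +_)
         (trans (sumS-cong (λ S → *-zeroʳ (𝟙 (h (inside ∷ S))))) (sumS-0 k)) ⟨
  sumS (λ S → 𝟙 (h S) * extensions S 0) ∎
  where open ≡-Reasoning
countL-leaves {suc k} h (suc r) = begin
  countL (λ U → h (outside ∷ leaves U) ∧ (wt U ≡ᵇ suc r))
    + (countL (λ U → h (outside ∷ leaves U) ∧ (wt U ≡ᵇ r)) + countL (λ U → h (inside ∷ leaves U) ∧ (wt U ≡ᵇ r)))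
    ≡⟨ cong₂ _+_ (countL-leaves (h ∘ (outside ∷_)) (suc r))
         (cong₂ _+_ (countL-leaves (h ∘ (outside ∷_)) r) (countL-leaves (h ∘ (inside ∷_)) r)) ⟩
  sumS (out (suc r)) + (sumS (out r) + inn)
    ≡⟨ +-assoc (sumS (out (suc r))) _ _ ⟨
  (sumS (out (suc r)) + sumS (out r)) + inn
    ≡⟨ cong (_+ inn) (sumS-+ (out (suc r)) (out r)) ⟨
  sumS (λ S → out (suc r) S + out r S) + inn
    ≡⟨ cong (_+ inn) (sumS-cong (λ S → *-distribˡ-+ (𝟙 (h (outside ∷ S))) (extensions S (suc r)) _)) ⟨
  sumS (λ S → 𝟙 (h S) * extensions S (suc r)) ∎
  where
  open ≡-Reasoning
  out : ℕ → Subset k → ℕ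
  out j S = 𝟙 (h (outside ∷ S)) * extensions S j
  inn = sumS (λ S → 𝟙 (h (inside ∷ S)) * extensions S r)

-- For s ≤ k this is binom (k ∸ s) (r ∸ s), or 0 when s > r.
levelWeight : ℕ → ℕ → ℕ → ℕ
levelWeight k       r       zero    = binom k r
levelWeight k       zero    (suc s) = 0
levelWeight zero    (suc r) (suc s) = 0
levelWeight (suc k) (suc r) (suc s) = levelWeight k r s

-- The range of `s` matters: for `k = r = 0` and `s = 1` the left side would be 1 and the right side
-- 0.
levelWeight-pascal : ∀ k r s → s ≤ k →
  levelWeight (suc k) (suc r) s ≡ levelWeight k r s + levelWeight k (suc r) s
levelWeight-pascal k       r       zero    _         = refl
levelWeight-pascal (suc k) zero    (suc s) (s≤s s≤k) = aux s
  where
  aux : ∀ s → levelWeight (suc k) 0 s ≡ levelWeight k 0 s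
  aux zero    = refl
  aux (suc s) = refl
levelWeight-pascal (suc k) (suc r) (suc s) (s≤s s≤k) = levelWeight-pascal k r s s≤k

extensions-levelWeight : ∀ {k} (S : Subset k) r → extensions S r ≡ levelWeight k r ∣ S ∣
extensions-levelWeight []            zero    = refl
extensions-levelWeight []            (suc r) = refl
extensions-levelWeight (inside ∷ S)  zero    = refl
extensions-levelWeight (inside ∷ S)  (suc r) = extensions-levelWeight S r
extensions-levelWeight {suc k} (outside ∷ S) zero = trans (extensions-levelWeight S zero) (aux ∣ S ∣)
  where
  aux : ∀ s → levelWeight k 0 s ≡ levelWeight (suc k) 0 s
  aux zero    = refl
  aux (suc s) = refl
extensions-levelWeight {suc k} (outside ∷ S) (suc r) = begin
  extensions S (suc r) + extensions S r
    ≡⟨ cong₂ _+_ (extensions-levelWeight S (suc r)) (extensions-levelWeight S r) ⟩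
  levelWeight k (suc r) ∣ S ∣ + levelWeight k r ∣ S ∣
    ≡⟨ +-comm (levelWeight k (suc r) ∣ S ∣) _ ⟩
  levelWeight k r ∣ S ∣ + levelWeight k (suc r) ∣ S ∣
    ≡⟨ levelWeight-pascal k r ∣ S ∣ (∣p∣≤n S) ⟨
  levelWeight (suc k) (suc r) ∣ S ∣ ∎
  where
  open ≡-Reasoning

binom-pos : ∀ {j m} → j ≤ m → 0 < binom m j
binom-pos z≤n       = s≤s z≤n
binom-pos (s≤s j≤m) = ≤-trans (binom-pos j≤m) (m≤m+n _ _)

levelWeight-top : ∀ {k r} → r ≤ k → levelWeight k r r ≡ 1
levelWeight-top z≤n       = refl
levelWeight-top (s≤s r≤k) = levelWeight-top r≤k

levelWeight-vanish : ∀ k r s → r < s → levelWeight k r s ≡ 0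
levelWeight-vanish k       zero    (suc s) _         = refl
levelWeight-vanish zero    (suc r) (suc s) _         = refl
levelWeight-vanish (suc k) (suc r) (suc s) (s≤s r<s) = levelWeight-vanish k r s r<s

-- The level `s = r`, of weight 1, is split off because it will be bounded together with the members
-- containing the root.
countL-levels : ∀ {k} (h : Family k) {r} → r ≤ k →
  countL (λ U → h (leaves U) ∧ (wt U ≡ᵇ r))
    ≡ sumTo r (λ s → count (level h s) * levelWeight k r s) + count (level h r)
countL-levels {k} h {r} r≤k = begin
  countL (λ U → h (leaves U) ∧ (wt U ≡ᵇ r))
    ≡⟨ countL-leaves h r ⟩
  sumS (λ S → 𝟙 (h S) * extensions S r)
    ≡⟨ sumS-cong (λ S → cong (𝟙 (h S) *_) (extensions-levelWeight S r)) ⟩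
  sumS (λ S → 𝟙 (h S) * levelWeight k r ∣ S ∣)
    ≡⟨ sumS-levels (suc r) h (levelWeight k r) (λ s → levelWeight-vanish k r s) ⟩
  sumTo r below + count (level h r) * levelWeight k r r
    ≡⟨ cong (λ z → sumTo r below + count (level h r) * z) (levelWeight-top r≤k) ⟩
  sumTo r below + count (level h r) * 1
    ≡⟨ cong (sumTo r below +_) (*-identityʳ _) ⟩
  sumTo r below + count (level h r) ∎
  where
  open ≡-Reasoning
  below : ℕ → ℕ
  below s = count (level h s) * levelWeight k r s

-- The bound for families on limbs

meet-mapˡ : ∀ {A B C : Set} {R : C → B → Set} (f : A → C) {m} {u : Vec A m} {v : Vec B m} →
  Meet (λ a b → R (f a) b) u v → Meet R (map f u) v
meet-mapˡ f (here r)  = here r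
meet-mapˡ f (there p) = there (meet-mapˡ f p)

meet-mapʳ : ∀ {A B C : Set} {R : A → C → Set} (f : B → C) {m} {u : Vec A m} {v : Vec B m} →
  Meet (λ a b → R a (f b)) u v → Meet R u (map f v)
meet-mapʳ f (here r)  = here r
meet-mapʳ f (there p) = there (meet-mapʳ f p)

meet-flip : ∀ {A B : Set} {R : A → B → Set} {Q : B → A → Set} → (∀ {a b} → R a b → Q b a) →
  ∀ {m} {u : Vec A m} {v : Vec B m} → Meet R u v → Meet Q v u
meet-flip h (here r)  = here (h r)
meet-flip h (there p) = there (meet-flip h p)

meet-lookup : ∀ {A B : Set} {R : A → B → Set} {m} {u : Vec A m} {v : Vec B m} →
  Meet R u v → ∃[ i ] R (lookup u i) (lookup v i)
meet-lookup (here r)  = Fin.zero , r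
meet-lookup (there p) = let i , r = meet-lookup p in Fin.suc i , r

lookup-meet : ∀ {A B : Set} {R : A → B → Set} {m} (u : Vec A m) (v : Vec B m) i →
  R (lookup u i) (lookup v i) → Meet R u v
lookup-meet (_ ∷ _) (_ ∷ _) Fin.zero    r = here r
lookup-meet (_ ∷ u) (_ ∷ v) (Fin.suc i) r = there (lookup-meet u v i r)

meet-size : ∀ {A : Set} {P : A → Set} {m} {u : Vec A m} {S : Subset m} →
  Meet (λ a b → P a × T b) u S → ∣ S ∣ ≢ 0
meet-size {S = inside ∷ _}  _         ()
meet-size {S = outside ∷ _} (here (_ , ()))
meet-size {S = outside ∷ _} (there p) eq = meet-size p eq

-- `A` and `P` are quantified after the point, so that the same point serves both for limb vectors
-- and for leaf sets.
singleton-point : ∀ {m} (S : Subset m) → ∣ S ∣ ≡ 1 → ∃[ a ]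
  (∀ {A : Set} {P : A → Set} (u : Vec A m) → Meet (λ x b → P x × T b) u S → P (lookup u a))
singleton-point (inside ∷ S) one = Fin.zero , λ where
  (_ ∷ _) (here (p , _)) → p
  (_ ∷ u) (there p)      → contradiction (suc-injective one) (meet-size p)
singleton-point (outside ∷ S) one = let a , h = singleton-point S one in Fin.suc a , λ where
  (_ ∷ u) (there p)      → h u p

lookup-leaves : ∀ {k} (U : Vec Limb k) i → lookup (leaves U) i ≡ isLeaf (lookup U i)
lookup-leaves U i = lookup-map i isLeaf U

∣leaves∣≤wt : ∀ {k} (U : Vec Limb k) → ∣ leaves U ∣ ≤ wt U
∣leaves∣≤wt []          = z≤n
∣leaves∣≤wt (none ∷ U)  = ∣leaves∣≤wt U
∣leaves∣≤wt (inner ∷ U) = m≤n⇒m≤1+n (∣leaves∣≤wt U)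
∣leaves∣≤wt (leaf ∷ U)  = s≤s (∣leaves∣≤wt U)

Within : ∀ {m} → Subset m → Subset m → Set
Within S X = ∀ i → T (lookup S i) → T (lookup X i)

within-∷ : ∀ {m} {S X : Subset m} b → Within S X → Within (b ∷ S) (b ∷ X)
within-∷ b h Fin.zero    t = t
within-∷ b h (Fin.suc i) t = h i t

within-out : ∀ {m b} {S X : Subset m} → Within S X → Within (outside ∷ S) (b ∷ X)
within-out h (Fin.suc i) t = h i t

choose : ∀ {m} (X : Subset m) j → j ≤ ∣ X ∣ → ∃[ S ] ∣ S ∣ ≡ j × Within S X
choose []            zero    _         = [] , refl , λ ()
choose (outside ∷ X) j       j≤        =
  let S , eq , h = choose X j j≤ in outside ∷ S , eq , within-out h
choose (inside ∷ X)  zero    _         =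
  let S , eq , h = choose X zero z≤n in outside ∷ S , eq , within-out h
choose (inside ∷ X)  (suc j) (s≤s j≤)  =
  let S , eq , h = choose X j j≤ in inside ∷ S , cong suc eq , within-∷ inside h

choose-with : ∀ {m} (X : Subset m) a j → T (lookup X a) → suc j ≤ ∣ X ∣ →
  ∃[ S ] ∣ S ∣ ≡ suc j × Within S X × T (lookup S a)
choose-with (outside ∷ X) (Fin.suc a) j t j<       =
  let S , eq , h , s = choose-with X a j t j< in outside ∷ S , eq , within-out h , s
choose-with (inside ∷ X)  Fin.zero    j t (s≤s j≤) =
  let S , eq , h = choose X j j≤ in inside ∷ S , cong suc eq , within-∷ inside h , tt
-- The first point, which differs from `a`, is dropped unless every point of the set is needed.
choose-with (inside ∷ X)  (Fin.suc a) j t j<       with m≤n⇒m<n∨m≡n j<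
... | inj₂ eq       = inside ∷ X , sym eq , (λ _ s → s) , t
... | inj₁ (s≤s j<′) =
  let S , eq , h , s = choose-with X a j t j<′ in outside ∷ S , eq , within-out h , s

T-not : ∀ {b} → T (not b) → ¬ T b
T-not {false} _ ()

lookup-∁ : ∀ {m} (S : Subset m) i → lookup (∁ S) i ≡ not (lookup S i)
lookup-∁ S i = lookup-map i not S

-- The members without the root of the `r`-star centred at the leaf of limb `a`;
-- `rootStar a (r - 1)` codes those with the root.
leafStar : ∀ {k} → Fin k → ℕ → LimbFamily k
leafStar a r U = lookup (leaves U) a ∧ (wt U ≡ᵇ r)

rootStar : ∀ {k} → Fin k → ℕ → Family k
rootStar a s S = lookup S a ∧ (∣ S ∣ ≡ᵇ s)

-- Independent r-sets are coded by limb vectors of weight r (root absent) and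
-- sets of r - 1 leaves (root present).
module Centre {k q : ℕ} (3+2q≤k : 3 + 2 * q ≤ k) (F : LimbFamily k) (H : Family k)
  (F-wt : ∀ U → T (F U) → wt U ≡ 2 + q) (H-size : ∀ S → T (H S) → ∣ S ∣ ≡ 1 + q)
  (FF : Cross Common F F) (FH : Cross LeafIn F H)
  (large : ∀ a → countL (leafStar {k} a (2 + q)) + count (rootStar {k} a (1 + q)) ≤ countL F + count H)
  where
  private
    -- With this `r` the hypothesis `3 + 2 * q ≤ k` reads 2r - 1 ≤ k.
    r = 2 + q

    2r≤1+k : 2 * r ≤ suc k
    2r≤1+k = ≤-trans (≤-reflexive (*-distribˡ-+ 2 2 q)) (s≤s 3+2q≤k)

    r≤k : r ≤ k
    r≤k = ≤-trans (s≤s (s≤s (≤-trans (m≤m+n q (q + 0)) (n≤1+n _)))) 3+2q≤k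

    G : LimbFamily k
    G = compress F

    G-wt : ∀ U → T (G U) → wt U ≡ r
    G-wt = compress-wt (_≡ r) F F-wt

    GG : Cross BothLeaf G G
    GG = compress-cross F F FF

    GH : Cross LeafIn G H
    GH = compress-crossˡ F H FH

    trG : Family k
    trG = trace G

    trG-cross : Cross BothIn trG trG
    trG-cross S S′ t t′ with trace-sound G S t | trace-sound G S′ t′
    ... | U , g , refl | V , g′ , refl = meet-mapˡ isLeaf (meet-mapʳ isLeaf (GG U V g g′))

    trG-H : Cross BothIn trG H
    trG-H S S′ t h with trace-sound G S t
    ... | U , g , refl = meet-mapˡ isLeaf (GH U S′ g h)

    -- Since 2s ≤ 2r - 2 < k, Erdős-Ko-Rado applies on the `k` limbs themselves, without an
    -- additional point.
    level-≤ : ∀ s → s < r → count (level trG s) ≤ starBound k s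
    level-≤ s s<r = ekr k s
      (≤-trans (*-monoʳ-≤ 2 (s≤s⁻¹ s<r)) (≤-trans (≤-reflexive (*-distribˡ-+ 2 1 q)) (≤-trans (n≤1+n _) 3+2q≤k)))
      (level trG s) (λ S → ≡ᵇ⇒≡ ∣ S ∣ s ∘ proj₂ ∘ ∧-T {trG S})
      (λ S S′ f g → trG-cross S S′ (proj₁ (∧-T f)) (proj₁ (∧-T g)))

    -- The root plays the role of one more point: the leaf sets of size r and the
    -- members containing the root form an intersecting family on k + 1 points.
    top : Family (suc k)
    top (outside ∷ S) = level trG r S
    top (inside ∷ S)  = H S

    top-≤ : count (level trG r) + count H ≤ starBound (suc k) r
    top-≤ = ekr (suc k) r 2r≤1+k top size cross
      where
      size : ∀ S → T (top S) → ∣ S ∣ ≡ r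
      size (outside ∷ S) = ≡ᵇ⇒≡ ∣ S ∣ r ∘ proj₂ ∘ ∧-T {trG S}
      size (inside ∷ S)  = cong suc ∘ H-size S
      cross : Cross BothIn top top
      cross (outside ∷ S) (outside ∷ S′) f g = there (trG-cross S S′ (proj₁ (∧-T f)) (proj₁ (∧-T g)))
      cross (outside ∷ S) (inside ∷ S′)  f g = there (trG-H S S′ (proj₁ (∧-T f)) g)
      cross (inside ∷ S)  (outside ∷ S′) f g = there (meet-flip swap (trG-H S′ S (proj₁ (∧-T g)) f))
      cross (inside ∷ S)  (inside ∷ S′)  f g = here (tt , tt)

    -- The compressed family is enlarged to all vectors of weight `r` having the same leaf set as
    -- one of its members.
    countF-≤ : countL F ≤ sumTo r (λ s → count (level trG s) * levelWeight k r s) + count (level trG r)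
    countF-≤ = begin
      countL F                                           ≡⟨ countL-compress F ⟨
      countL G                                           ≤⟨ sumL-mono (λ U → 𝟙-mono (G⊆ U)) ⟩
      countL (λ U → trG (leaves U) ∧ (wt U ≡ᵇ r))        ≡⟨ countL-levels trG r≤k ⟩
      sumTo r (λ s → count (level trG s) * levelWeight k r s) + count (level trG r) ∎
      where
      open ≤-Reasoning
      G⊆ : ∀ U → T (G U) → T (trG (leaves U) ∧ (wt U ≡ᵇ r))
      G⊆ U g = T-∧-intro (trace-complete G U g) (≡⇒≡ᵇ (wt U) r (G-wt U g))

  private
    -- The star of the first limb's leaf attains the bound on every level. An empty level 1 falls
    -- short of it by C(k - 1, r - 1), which is positive.
    no-singleton-small : ∀ {k′} → k ≡ suc k′ → count (level trG 1) ≡ 0 →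
      ∃[ a ] countL F + count H < countL (leafStar {k} a r) + count (rootStar {k} a (suc q))
    no-singleton-small {k′} refl empty = Fin.zero , (begin-strict
      countL F + count H
        ≤⟨ +-monoˡ-≤ (count H) countF-≤ ⟩
      (sumTo r (λ s → count (level trG s) * levelWeight k r s) + count (level trG r)) + count H
        ≡⟨ +-assoc (sumTo r (λ s → count (level trG s) * levelWeight k r s)) _ _ ⟩
      sumTo r (λ s → count (level trG s) * levelWeight k r s) + (count (level trG r) + count H)
        <⟨ +-mono-<-≤ below top-≤ ⟩
      sumTo r (λ s → count (level head s) * levelWeight k r s) + starBound (suc k) r
        ≡⟨ cong (sumTo r (λ s → count (level head s) * levelWeight k r s) +_) top-star ⟩
      sumTo r (λ s → count (level head s) * levelWeight k r s) + (count (level head r) + count (level head (suc q)))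
        ≡⟨ +-assoc (sumTo r (λ s → count (level head s) * levelWeight k r s)) _ _ ⟨
      (sumTo r (λ s → count (level head s) * levelWeight k r s) + count (level head r)) + count (level head (suc q))
        ≡⟨ cong (_+ count (level head (suc q))) (countL-levels head r≤k) ⟨
      countL (leafStar {k} Fin.zero r) + count (rootStar {k} Fin.zero (suc q)) ∎)
      where
      open ≤-Reasoning
      head : Family k
      head S = lookup S Fin.zero
      -- Pascal's rule splits the bound on `k + 1` points into the star's leaf sets of size `r` and
      -- its members with the root.
      top-star : starBound (suc k) r ≡ count (level head r) + count (level head (suc q))
      top-star = trans (starBound-pascal {k} (suc q) (s≤s z≤n))
        (sym (cong₂ _+_ (count-star {k′} r) (count-star {k′} (suc q))))
      below : sumTo r (λ s → count (level trG s) * levelWeight k r s)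
            < sumTo r (λ s → count (level head s) * levelWeight k r s)
      below = sumTo-strict {1} r
        (λ s s<r → *-monoˡ-≤ (levelWeight k r s) (≤-trans (level-≤ s s<r) (≤-reflexive (sym (count-star {k′} s)))))
        (s≤s (s≤s z≤n))
        (subst₂ (λ x y → x * levelWeight k r 1 < y * levelWeight k r 1) (sym empty) (sym (count-star {k′} 1))
          (≤-trans (binom-pos (s≤s⁻¹ r≤k)) (≤-reflexive (sym (+-identityʳ (binom k′ (suc q)))))))

    pos : ∃[ k′ ] k ≡ suc k′
    pos = ≤⇒∃suc r≤k
      where
      ≤⇒∃suc : ∀ {i m} → suc i ≤ m → ∃[ m′ ] m ≡ suc m′
      ≤⇒∃suc (s≤s _) = _ , refl

    singleton : ∃[ S ] T (level trG 1 S)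
    singleton = count-∃ (level trG 1) λ empty →
      let a , small = no-singleton-small (proj₂ pos) empty in <⇒≱ small (large a)

    sharp : ∃[ U ] T (G U) × ∣ leaves U ∣ ≡ 1
    sharp = let S , t = singleton
                U , g , eq = trace-sound G S (proj₁ (∧-T t))
            in U , g , trans (cong ∣_∣ eq) (≡ᵇ⇒≡ ∣ S ∣ 1 (proj₂ (∧-T {trG S} t)))

    point = singleton-point (leaves (proj₁ sharp)) (proj₂ (proj₂ sharp))

  centre : Fin k
  centre = proj₁ point

  private
    -- Every compressed member shares a leaf with the one-leaf member `sharp`, and that leaf can
    -- only be the centre.
    G-centre : ∀ U → T (G U) → T (isLeaf (lookup U centre))
    G-centre U g = proj₂ point {P = T ∘ isLeaf} U (meet-mapʳ isLeaf (GG U (proj₁ sharp) g (proj₁ (proj₂ sharp))))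

  H-centre : ∀ S → T (H S) → T (lookup S centre)
  H-centre S h = proj₂ point {P = T} S (meet-mapʳ isLeaf (meet-flip swap (GH (proj₁ sharp) S (proj₁ (proj₂ sharp)) h)))

  private
    -- The compressed vectors lie in the star of the centre, so `large` leaves no room for a gap in
    -- the part of that star containing the root.
    H-full : ∀ S → T (lookup S centre) → ∣ S ∣ ≡ suc q → T (H S)
    H-full S t eq = count-full H⊆ enough S (T-∧-intro t (≡⇒≡ᵇ ∣ S ∣ (suc q) eq))
      where
      open ≤-Reasoning
      H⊆ : ∀ S → T (H S) → T (rootStar centre (suc q) S)
      H⊆ S h = T-∧-intro (H-centre S h) (≡⇒≡ᵇ ∣ S ∣ (suc q) (H-size S h))
      G⊆ : ∀ U → T (G U) → T (leafStar centre r U)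
      G⊆ U g = T-∧-intro (subst T (sym (lookup-leaves U centre)) (G-centre U g)) (≡⇒≡ᵇ (wt U) r (G-wt U g))
      enough : count (rootStar {k} centre (suc q)) ≤ count H
      enough = +-cancelˡ-≤ (countL (leafStar {k} centre r)) _ _ (begin
        countL (leafStar {k} centre r) + count (rootStar {k} centre (suc q))  ≤⟨ large centre ⟩
        countL F + count H      ≡⟨ cong (_+ count H) (countL-compress F) ⟨
        countL G + count H      ≤⟨ +-monoˡ-≤ (count H) (sumL-mono (λ U → 𝟙-mono (G⊆ U))) ⟩
        countL (leafStar {k} centre r) + count H ∎)

    -- An inner vertex at the centre is ruled out by a member of H whose leaves
    -- avoid those of U.
    no-inner : ∀ U → T (F U) → lookup U centre ≢ inner
    no-inner U f eq =
      let S , size , within , t = choose-with (∁ (leaves U)) centre q outside-leaves room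
          i , l , s = meet-lookup (FH U S f (H-full S t size))
      in T-not (subst T (lookup-∁ (leaves U) i) (within i s)) (subst T (sym (lookup-leaves U i)) l)
      where
      outside-leaves : T (lookup (∁ (leaves U)) centre)
      outside-leaves = subst T (sym (trans (lookup-∁ (leaves U) centre)
        (cong not (trans (lookup-leaves U centre) (cong isLeaf eq))))) tt
      -- At least k - r ≥ r - 1 limbs carry no leaf of `U`, enough for the leaves of a member of
      -- `H`.
      room : suc q ≤ ∣ ∁ (leaves U) ∣
      room = +-cancelˡ-≤ ∣ leaves U ∣ _ _ (begin
        ∣ leaves U ∣ + suc q              ≤⟨ +-monoˡ-≤ (suc q) (∣leaves∣≤wt U) ⟩
        wt U + suc q                      ≡⟨ cong (_+ suc q) (F-wt U f) ⟩
        2 + q + suc q                     ≡⟨ cong (2 +_) (trans (+-suc q q) (cong (λ z → suc (q + z)) (sym (+-identityʳ q)))) ⟩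
        3 + 2 * q                         ≤⟨ 3+2q≤k ⟩
        k                                 ≡⟨ ∣p∣+∣∁p∣≡n (leaves U) ⟨
        ∣ leaves U ∣ + ∣ ∁ (leaves U) ∣   ∎)
        where open ≤-Reasoning

  -- If `U` missed the centre's limb, its lift by `compress-lift` would have no leaf there, contrary
  -- to `G-centre`.
  F-centre : ∀ U → T (F U) → lookup U centre ≡ leaf
  F-centre U f with lookup U centre in eq | compress-lift F U f
  ... | leaf  | _         = refl
  ... | inner | _         = contradiction eq (no-inner U f)
  ... | none  | V , g , h = contradiction eq (h centre (G-centre V g))

-- The structure of a depth-two claw

unique-⊆-length : ∀ {A : Set} {xs ys : List A} → Unique xs → (∀ {x} → x ∈ₗ xs → x ∈ₗ ys) →
  length xs ≤ length ys
unique-⊆-length []             _   = z≤n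
unique-⊆-length {xs = x ∷ xs} (x∉ ∷ uniq) sub with ∈-∃++ (sub (here refl))
... | as , bs , refl = begin
  suc (length xs)          ≤⟨ s≤s (unique-⊆-length uniq rest) ⟩
  suc (length (as ++ bs))  ≡⟨ List.length-++-sucʳ as x bs ⟨
  length (as ++ x ∷ bs)    ∎
  where
  open ≤-Reasoning
  rest : ∀ {z} → z ∈ₗ xs → z ∈ₗ as ++ bs
  rest z∈xs with ∈-++⁻ as (sub (there z∈xs))
  ... | inj₁ z∈as           = ∈-++⁺ˡ z∈as
  ... | inj₂ (here refl)    = contradiction refl (All.lookup x∉ z∈xs)
  ... | inj₂ (there z∈bs)   = ∈-++⁺ʳ as z∈bs

-- Injectivity is expressed by a left inverse on the members of `xs` only, as sets are recovered
-- from their codes only when they are independent.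
unique-inj-length : ∀ {A B : Set} {f : A → B} (g : B → A) {xs : List A} {ys : List B} → Unique xs →
  (∀ {x} → x ∈ₗ xs → g (f x) ≡ x) → (∀ {x} → x ∈ₗ xs → f x ∈ₗ ys) → length xs ≤ length ys
unique-inj-length {f = f} g {xs} {ys} uniq gf into = begin
  length xs              ≡⟨ List.length-map f xs ⟨
  length (List.map f xs) ≤⟨ unique-⊆-length
    (Unique.map⁻ {f = g} (subst Unique (trans (sym (List.map-id-local {f = g ∘ f} (All.tabulate gf))) (List.map-∘ xs)) uniq))
    (λ y∈ → let x , x∈ , eq = ∈-map⁻ f y∈ in subst (_∈ₗ ys) (sym eq) (into x∈)) ⟩
  length ys              ∎
  where open ≤-Reasoning

unique-lookup-injective : ∀ {A : Set} {xs : List A} → Unique xs → ∀ i j →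
  List.lookup xs i ≡ List.lookup xs j → i ≡ j
unique-lookup-injective (_ ∷ _)    Fin.zero    Fin.zero    _  = refl
unique-lookup-injective {xs = _ ∷ xs} (x∉ ∷ _) Fin.zero (Fin.suc j) eq =
  contradiction eq (All.lookup x∉ (∈-lookup {xs = xs} j))
unique-lookup-injective {xs = _ ∷ xs} (x∉ ∷ _) (Fin.suc i) Fin.zero eq =
  contradiction (sym eq) (All.lookup x∉ (∈-lookup {xs = xs} i))
unique-lookup-injective (_ ∷ uniq) (Fin.suc i) (Fin.suc j) eq =
  cong Fin.suc (unique-lookup-injective uniq i j eq)

length-1-≡ : ∀ {A : Set} {xs : List A} {a b} → length xs ≡ 1 → a ∈ₗ xs → b ∈ₗ xs → a ≡ b
length-1-≡ {xs = _ ∷ []} _ (here refl) (here refl) = refl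

length-2-≡ : ∀ {A : Set} {xs : List A} {a b c} → length xs ≡ 2 → a ∈ₗ xs → b ∈ₗ xs → a ≢ b →
  c ∈ₗ xs → c ≡ a ⊎ c ≡ b
length-2-≡ {xs = _ ∷ _ ∷ []} _ (here refl)         (here refl)         a≢b _                   = contradiction refl a≢b
length-2-≡ {xs = _ ∷ _ ∷ []} _ (here refl)         (there (here refl)) a≢b (here refl)         = inj₁ refl
length-2-≡ {xs = _ ∷ _ ∷ []} _ (here refl)         (there (here refl)) a≢b (there (here refl)) = inj₂ refl
length-2-≡ {xs = _ ∷ _ ∷ []} _ (there (here refl)) (here refl)         a≢b (here refl)         = inj₂ refl
length-2-≡ {xs = _ ∷ _ ∷ []} _ (there (here refl)) (here refl)         a≢b (there (here refl)) = inj₁ refl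
length-2-≡ {xs = _ ∷ _ ∷ []} _ (there (here refl)) (there (here refl)) a≢b _                   = contradiction refl a≢b

length-2-other : ∀ {A : Set} {xs : List A} {a} → Unique xs → length xs ≡ 2 → a ∈ₗ xs →
  ∃[ b ] b ∈ₗ xs × b ≢ a
length-2-other {xs = _ ∷ b ∷ []} ((a≢b ∷ []) ∷ _) _ (here refl) = b , there (here refl) , a≢b ∘ sym
length-2-other {xs = b ∷ _ ∷ []} ((b≢a ∷ []) ∷ _) _ (there (here refl)) = b , here refl , b≢a

data Role (k : ℕ) : Set where
  root  : Role k
  inner : Fin k → Role k
  leaf  : Fin k → Role k

data Adj {k : ℕ} : Role k → Role k → Set where
  root-inner : ∀ {i} → Adj root (inner i)
  inner-root : ∀ {i} → Adj (inner i) root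
  inner-leaf : ∀ {i} → Adj (inner i) (leaf i)
  leaf-inner : ∀ {i} → Adj (leaf i) (inner i)

-- G is the claw with k limbs root - inner i - leaf i.
record Limbs {n : ℕ} (G : Graph n) (k : ℕ) : Set where
  open Graph G
  field
    vertex      : Role k → Fin n
    role        : Fin n → Role k
    vertex-role : ∀ v → vertex (role v) ≡ v
    role-vertex : ∀ z → role (vertex z) ≡ z
    root~inner  : ∀ i → vertex root ~ vertex (inner i)
    inner~leaf  : ∀ i → vertex (inner i) ~ vertex (leaf i)
    adjacent    : ∀ z z′ → vertex z ~ vertex z′ → Adj z z′

-- Degrees, paths and cycles

module _ {n : ℕ} (G : Graph n) where
  open Graph G

  private
    neighbour : ∀ {v w} → v ~ w → w ∈ₗ filter (v ~?_) (allFin n)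
    neighbour {v} {w} v~w = ∈-filter⁺ (v ~?_) (∈-allFin w) v~w

  degree-1-≡ : ∀ {v a b} → degree G v ≡ 1 → v ~ a → v ~ b → a ≡ b
  degree-1-≡ d v~a v~b = length-1-≡ d (neighbour v~a) (neighbour v~b)

  degree-2-≡ : ∀ {v a b c} → degree G v ≡ 2 → v ~ a → v ~ b → a ≢ b → v ~ c → c ≡ a ⊎ c ≡ b
  degree-2-≡ d v~a v~b a≢b v~c = length-2-≡ d (neighbour v~a) (neighbour v~b) a≢b (neighbour v~c)

  degree-2-other : ∀ {v a} → degree G v ≡ 2 → v ~ a → ∃[ b ] v ~ b × b ≢ a
  degree-2-other {v} d v~a =
    let b , b∈ , b≢a = length-2-other (Unique.filter⁺ (v ~?_) (Unique.allFin⁺ n)) d (neighbour v~a)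
    in b , proj₂ (∈-filter⁻ (v ~?_) {xs = allFin n} b∈) , b≢a

  end∈vertices : ∀ {u v} (p : Walk G u v) → v ∈ₗ vertices G p
  end∈vertices ε       = here refl
  end∈vertices (_ ◅ p) = there (end∈vertices p)

  length-vertices : ∀ {u v} (p : Walk G u v) → length (vertices G p) ≡ suc (walkLength G p)
  length-vertices ε       = refl
  length-vertices (_ ◅ p) = cong suc (length-vertices p)

  path-prefix : ∀ {u v w} (p : Walk G u v) → IsPath G p → w ∈ₗ vertices G p →
    Σ[ q ∈ Walk G u w ] IsPath G q × (∀ {x} → x ∈ₗ vertices G q → x ∈ₗ vertices G p)
  path-prefix ε       path       (here refl) = ε , path , id
  path-prefix (e ◅ p) _          (here refl) = ε , [] ∷ [] , λ { (here eq) → here eq }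
  path-prefix (e ◅ p) (u∉ ∷ path) (there w∈) =
    let q , q-path , sub = path-prefix p path w∈
    in e ◅ q , All.tabulate (All.lookup u∉ ∘ sub) ∷ q-path
     , λ { (here eq) → here eq ; (there x∈) → there (sub x∈) }

  -- The part of the path up to `w`, closed by the chord, is a cycle; since `w` is not the second
  -- vertex, this part has at least two edges.
  chord-cycle : ∀ {u u′ v w} (e : u ~ u′) (p : Walk G u′ v) → IsPath G (e ◅ p) →
    u ~ w → w ≢ u′ → w ∈ₗ vertices G (e ◅ p) → HasCycle G
  chord-cycle e p _           u~w w≢u′ (here refl) = contradiction u~w (~-irrefl refl)
  chord-cycle {u} {w = w} e p (u∉ ∷ path) u~w w≢u′ (there w∈) with path-prefix p path w∈
  ... | ε , _ , _                 = contradiction refl w≢u′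
  ... | e′ ◅ q , q-path , sub =
    u , w , e ◅ e′ ◅ q , All.tabulate (All.lookup u∉ ∘ sub) ∷ q-path , s≤s (s≤s z≤n) , ~-sym u~w

module _ {n : ℕ} (G : Graph n) (c : Fin n) (claw : IsDepthTwoClaw G c) where
  open Graph G

  private
    connected : Connected G
    connected = proj₁ (proj₁ (proj₁ claw))
    acyclic : ¬ HasCycle G
    acyclic = proj₂ (proj₁ (proj₁ claw))
    degrees : ∀ v → v ≢ c → degree G v ≡ 1 ⊎ degree G v ≡ 2
    degrees = proj₂ (proj₁ claw)

    leaf? : ∀ v → Dec (IsLeaf G c v)
    leaf? v = ¬? (v Fin.≟ c) ×-dec (degree G v ≟ 1)

    -- Limbs are indexed by the leaves: each leaf determines its inner vertex as the midpoint of a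
    -- walk of length 2 from the root.
    leafList : List (Fin n)
    leafList = filter leaf? (allFin n)

    leafList-unique : Unique leafList
    leafList-unique = Unique.filter⁺ leaf? (Unique.allFin⁺ n)

  limbCount : ℕ
  limbCount = length leafList

  private
    y : Fin limbCount → Fin n
    y = List.lookup leafList

    y-leaf : ∀ i → IsLeaf G c (y i)
    y-leaf i = proj₂ (∈-filter⁻ leaf? {xs = allFin n} (∈-lookup {xs = leafList} i))

    midpoint : ∀ {v} → Distance G c v 2 → ∃[ u ] c ~ u × u ~ v
    midpoint ((e ◅ e′ ◅ ε , _) , _) = _ , e , e′
    midpoint ((ε , ()) , _)
    midpoint ((_ ◅ ε , ()) , _)
    midpoint ((_ ◅ _ ◅ _ ◅ _ , ()) , _)

    x : Fin limbCount → Fin n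
    x i = proj₁ (midpoint (proj₂ claw (y i) (y-leaf i)))

    c~x : ∀ i → c ~ x i
    c~x i = proj₁ (proj₂ (midpoint (proj₂ claw (y i) (y-leaf i))))

    x~y : ∀ i → x i ~ y i
    x~y i = proj₂ (proj₂ (midpoint (proj₂ claw (y i) (y-leaf i))))

    c≢x : ∀ i → c ≢ x i
    c≢x i eq = ~-irrefl eq (c~x i)

    c≢y : ∀ i → c ≢ y i
    c≢y i = proj₁ (y-leaf i) ∘ sym

    x-degree : ∀ i → degree G (x i) ≡ 2
    x-degree i with degrees (x i) (c≢x i ∘ sym)
    ... | inj₁ d = contradiction (degree-1-≡ G d (~-sym (c~x i)) (x~y i)) (c≢y i)
    ... | inj₂ d = d

    x≢y : ∀ i j → x i ≢ y j
    x≢y i j eq = case trans (sym (x-degree i)) (trans (cong (degree G) eq) (proj₂ (y-leaf j))) of λ ()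

    x-neighbour : ∀ i {w} → x i ~ w → w ≡ c ⊎ w ≡ y i
    x-neighbour i = degree-2-≡ G (x-degree i) (~-sym (c~x i)) (x~y i) (c≢y i)

    y-neighbour : ∀ i {w} → y i ~ w → w ≡ x i
    y-neighbour i y~w = degree-1-≡ G (proj₂ (y-leaf i)) y~w (~-sym (x~y i))

    y-injective : ∀ {i j} → y i ≡ y j → i ≡ j
    y-injective = unique-lookup-injective leafList-unique _ _

    x-injective : ∀ {i j} → x i ≡ x j → i ≡ j
    x-injective {i} {j} eq with x-neighbour i (subst (_~ y j) (sym eq) (x~y j))
    ... | inj₁ yj≡c  = contradiction (sym yj≡c) (c≢y j)
    ... | inj₂ yj≡yi = y-injective (sym yj≡yi)

    vertex : Role limbCount → Fin n
    vertex root      = c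
    vertex (inner i) = x i
    vertex (leaf i)  = y i

    vertex-injective : ∀ z z′ → vertex z ≡ vertex z′ → z ≡ z′
    vertex-injective root      root      _  = refl
    vertex-injective root      (inner j) eq = contradiction eq (c≢x j)
    vertex-injective root      (leaf j)  eq = contradiction eq (c≢y j)
    vertex-injective (inner i) root      eq = contradiction (sym eq) (c≢x i)
    vertex-injective (inner i) (inner j) eq = cong inner (x-injective eq)
    vertex-injective (inner i) (leaf j)  eq = contradiction eq (x≢y i j)
    vertex-injective (leaf i)  root      eq = contradiction (sym eq) (c≢y i)
    vertex-injective (leaf i)  (inner j) eq = contradiction (sym eq) (x≢y j i)
    vertex-injective (leaf i)  (leaf j)  eq = cong leaf (y-injective eq)

    Covered : Fin n → Set
    Covered v = ∃[ z ] vertex z ≡ v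

    covered? : ∀ v → Dec (Covered v)
    covered? v with c Fin.≟ v
    ... | yes eq = yes (root , eq)
    ... | no  c≢v with Fin.any? (λ i → x i Fin.≟ v) | Fin.any? (λ i → y i Fin.≟ v)
    ... | yes (i , eq) | _            = yes (inner i , eq)
    ... | no  _        | yes (i , eq) = yes (leaf i , eq)
    ... | no  ¬x       | no ¬y        = no λ where
      (root , eq)    → c≢v eq
      (inner i , eq) → ¬x (i , eq)
      (leaf i , eq)  → ¬y (i , eq)

    covered-closed : ∀ {v w} → Covered v → v ≢ c → v ~ w → Covered w
    covered-closed (root , refl)    v≢c _   = contradiction refl v≢c
    covered-closed (inner i , refl) _   v~w = [ (λ eq → root , sym eq) , (λ eq → leaf i , sym eq) ]′ (x-neighbour i v~w)
    covered-closed (leaf i , refl)  _   v~w = inner i , sym (y-neighbour i v~w)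

    leaf-covered : ∀ {v} → IsLeaf G c v → Covered v
    leaf-covered {v} l = leaf (index v∈) , sym (lookup-index v∈)
      where v∈ = ∈-filter⁺ leaf? (∈-allFin v) l

    -- By `covered-closed` a walk leaves the covered vertices only at the root.
    escape : ∀ {u v} → Walk G u v → Covered u → ¬ Covered v → ∃[ w ] c ~ w × ¬ Covered w
    escape ε cu ¬cv = contradiction cu ¬cv
    escape {u} (_◅_ {j = w} e p) cu ¬cv with covered? w
    ... | yes cw = escape p cw ¬cv
    ... | no ¬cw with u Fin.≟ c
    ...   | yes refl = w , e , ¬cw
    ...   | no  u≢c  = contradiction (covered-closed cu u≢c e) ¬cw

    -- A path from an uncovered vertex to the root can always be prolonged
    -- backwards: its first vertex is no leaf and the graph has no cycle.
    longPath : ∀ {w} → c ~ w → ¬ Covered w → ∀ m →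
      ∃[ u ] Σ[ p ∈ Walk G u c ] IsPath G p × ¬ Covered u × walkLength G p ≡ suc m
    longPath {w} c~w ¬cw zero =
      w , ~-sym c~w ◅ ε , ((λ eq → ~-irrefl (sym eq) c~w) ∷ []) ∷ [] ∷ [] , ¬cw , refl
    longPath c~w ¬cw (suc m) with longPath c~w ¬cw m
    ... | u , e ◅ p , path , ¬cu , len with degrees u (λ { refl → ¬cu (root , refl) })
    ...   | inj₁ d = contradiction (leaf-covered ((λ { refl → ¬cu (root , refl) }) , d)) ¬cu
    ...   | inj₂ d with degree-2-other G d e
    ...     | b , u~b , b≢u′ =
      b , ~-sym u~b ◅ e ◅ p , All.tabulate (λ x∈ eq → fresh (subst (_∈ₗ vertices G (e ◅ p)) (sym eq) x∈)) ∷ path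
        -- The root lies on the path and `b` does not, so `b` is not the root; were it covered, its
        -- neighbour `u` would be covered too.
        , (λ cb → ¬cu (covered-closed cb (λ { refl → fresh (end∈vertices G (e ◅ p)) }) (~-sym u~b)))
        , cong suc len
      where
      fresh : b ∉ₗ vertices G (e ◅ p)
      fresh = acyclic ∘ chord-cycle G e p path u~b b≢u′

    -- An uncovered vertex would lead to a path with `n + 1` edges, hence with `n + 2` distinct
    -- vertices.
    covered : ∀ v → Covered v
    covered v with covered? v
    ... | yes cv = cv
    ... | no ¬cv =
      let w , c~w , ¬cw = escape (connected c v) (root , refl) ¬cv
          u , p , path , _ , len = longPath c~w ¬cw n
      in contradiction
        (subst₂ _≤_ (trans (length-vertices G p) (cong suc len)) (List.length-tabulate {n = n} id)
          (unique-⊆-length path λ {x} _ → ∈-allFin x))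
        (<⇒≱ (s≤s (n≤1+n n)))

    adjacent : ∀ z z′ → vertex z ~ vertex z′ → Adj z z′
    adjacent root      root      e = contradiction e (~-irrefl refl)
    adjacent root      (inner j) e = root-inner
    adjacent root      (leaf j)  e = contradiction (y-neighbour j (~-sym e)) (c≢x j)
    adjacent (inner i) root      e = inner-root
    adjacent (inner i) (inner j) e with x-neighbour i e
    ... | inj₁ eq = contradiction (sym eq) (c≢x j)
    ... | inj₂ eq = contradiction eq (x≢y j i)
    adjacent (inner i) (leaf j)  e with x-neighbour i e
    ... | inj₁ eq = contradiction (sym eq) (c≢y j)
    ... | inj₂ eq with refl ← y-injective eq = inner-leaf
    adjacent (leaf i)  root      e = contradiction (y-neighbour i e) (c≢x i)
    adjacent (leaf i)  (inner j) e with refl ← x-injective (y-neighbour i e) = leaf-inner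
    adjacent (leaf i)  (leaf j)  e = contradiction (sym (y-neighbour i e)) (x≢y i j)

  limbs : Limbs G limbCount
  limbs = record
    { vertex      = vertex
    ; role        = proj₁ ∘ covered
    ; vertex-role = proj₂ ∘ covered
    ; role-vertex = λ z → vertex-injective _ z (proj₂ (covered (vertex z)))
    ; root~inner  = c~x
    ; inner~leaf  = x~y
    ; adjacent    = adjacent
    }

-- Independent sets as families on limbs

T-does : ∀ {P : Set} (d : Dec P) → P → T (does d)
T-does (yes _) _ = tt
T-does (no ¬p) p = contradiction p ¬p

does-T : ∀ {P : Set} (d : Dec P) → T (does d) → P
does-T (yes p) _ = p

length-filter-map : ∀ {A B : Set} {P : Pred B 0ℓ} (P? : Decidable P) (f : A → B) xs →
  length (filter P? (List.map f xs)) ≡ length (filter (P? ∘ f) xs)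
length-filter-map P? f []       = refl
length-filter-map P? f (x ∷ xs) with does (P? (f x))
... | true  = cong suc (length-filter-map P? f xs)
... | false = length-filter-map P? f xs

length-filter-++ : ∀ {A : Set} {P : Pred A 0ℓ} (P? : Decidable P) xs ys →
  length (filter P? (xs ++ ys)) ≡ length (filter P? xs) + length (filter P? ys)
length-filter-++ P? xs ys = trans (cong length (List.filter-++ P? xs ys)) (List.length-++ (filter P? xs))

card-count : ∀ {m} {P : Pred (Subset m) 0ℓ} (P? : Decidable P) → card P? ≡ count (does ∘ P?)
card-count {zero}  P? with does (P? [])
... | true  = refl
... | false = refl
card-count {suc m} P? = trans (length-filter-++ P? (List.map (outside ∷_) (subsets m)) _) (cong₂ _+_
  (trans (length-filter-map P? (outside ∷_) (subsets m)) (card-count (P? ∘ (outside ∷_))))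
  (trans (length-filter-map P? (inside ∷_) (subsets m)) (card-count (P? ∘ (inside ∷_)))))

limbVectors : ∀ k → List (Vec Limb k)
limbVectors zero    = [] ∷ []
limbVectors (suc k) = List.map (none ∷_) (limbVectors k)
  ++ (List.map (inner ∷_) (limbVectors k) ++ List.map (leaf ∷_) (limbVectors k))

countL-length : ∀ {k} (F : LimbFamily k) → length (filter (T? ∘ F) (limbVectors k)) ≡ countL F
countL-length {zero}  F with F []
... | true  = refl
... | false = refl
countL-length {suc k} F = trans (length-filter-++ F? (List.map (none ∷_) (limbVectors k)) _) (cong₂ _+_ (part none)
  (trans (length-filter-++ F? (List.map (inner ∷_) (limbVectors k)) _) (cong₂ _+_ (part inner) (part leaf))))
  where
  F? = T? ∘ F
  part : ∀ x → length (filter F? (List.map (x ∷_) (limbVectors k))) ≡ countL (F ∘ (x ∷_))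
  part x = trans (length-filter-map F? (x ∷_) (limbVectors k)) (countL-length (F ∘ (x ∷_)))

∈-subsets : ∀ {m} (S : Subset m) → S ∈ₗ subsets m
∈-subsets []            = here refl
∈-subsets (outside ∷ S) = ∈-++⁺ˡ (∈-map⁺ (outside ∷_) (∈-subsets S))
∈-subsets (inside ∷ S)  = ∈-++⁺ʳ _ (∈-map⁺ (inside ∷_) (∈-subsets S))

∈-limbVectors : ∀ {k} (U : Vec Limb k) → U ∈ₗ limbVectors k
∈-limbVectors []          = here refl
∈-limbVectors (none ∷ U)  = ∈-++⁺ˡ (∈-map⁺ (none ∷_) (∈-limbVectors U))
∈-limbVectors {suc k} (inner ∷ U) = ∈-++⁺ʳ (List.map (none ∷_) (limbVectors k)) (∈-++⁺ˡ (∈-map⁺ (inner ∷_) (∈-limbVectors U)))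
∈-limbVectors {suc k} (leaf ∷ U)  = ∈-++⁺ʳ (List.map (none ∷_) (limbVectors k))
  (∈-++⁺ʳ (List.map (inner ∷_) (limbVectors k)) (∈-map⁺ (leaf ∷_) (∈-limbVectors U)))

map-disjoint : ∀ {A B C : Set} {f : A → C} {g : B → C} {xs ys} → (∀ a b → f a ≢ g b) →
  ∀ {v} → ¬ (v ∈ₗ List.map f xs × v ∈ₗ List.map g ys)
map-disjoint {f = f} {g} apart (v∈ , v∈′) with ∈-map⁻ f v∈ | ∈-map⁻ g v∈′
... | a , _ , eq | b , _ , eq′ = apart a b (trans (sym eq) eq′)

subsets-unique : ∀ m → Unique (subsets m)
subsets-unique zero    = [] ∷ []
subsets-unique (suc m) = Unique.++⁺ (Unique.map⁺ ∷-injectiveʳ (subsets-unique m))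
  (Unique.map⁺ ∷-injectiveʳ (subsets-unique m)) (map-disjoint λ _ _ ())

limbVectors-unique : ∀ k → Unique (limbVectors k)
limbVectors-unique zero    = [] ∷ []
limbVectors-unique (suc k) = Unique.++⁺ (part none)
  (Unique.++⁺ (part inner) (part leaf) (map-disjoint λ _ _ ()))
  λ (v∈ , v∈′) → [ (λ w → map-disjoint (λ _ _ ()) (v∈ , w)) , (λ w → map-disjoint (λ _ _ ()) (v∈ , w)) ]′
    (∈-++⁻ (List.map (inner ∷_) (limbVectors k)) v∈′)
  where
  part : ∀ x → Unique (List.map {B = Vec Limb (suc k)} (x ∷_) (limbVectors k))
  part x = Unique.map⁺ ∷-injectiveʳ (limbVectors-unique k)

length-filter-tabulate : ∀ {A : Set} {m} (f : Fin m → A) (p : A → Bool) →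
  length (filter (T? ∘ p) (List.tabulate f)) ≡ ∣ tabulate (p ∘ f) ∣
length-filter-tabulate {m = zero}  f p = refl
length-filter-tabulate {m = suc m} f p with p (f Fin.zero)
... | true  = cong suc (length-filter-tabulate (f ∘ Fin.suc) p)
... | false = length-filter-tabulate (f ∘ Fin.suc) p

∈⇒T : ∀ {m} {S : Subset m} {i} → i ∈ S → T (lookup S i)
∈⇒T i∈S = subst T (sym ([]=⇒lookup i∈S)) tt

T⇒∈ : ∀ {m} (S : Subset m) i → T (lookup S i) → i ∈ S
T⇒∈ S i t with lookup S i in eq
... | true = lookup⇒[]= i S eq

isInner : Limb → Bool
isInner inner = true
isInner _     = false

wt-split : ∀ {k} (U : Vec Limb k) → ∣ map isInner U ∣ + ∣ leaves U ∣ ≡ wt U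
wt-split []          = refl
wt-split (none ∷ U)  = wt-split U
wt-split (inner ∷ U) = cong suc (wt-split U)
wt-split (leaf ∷ U)  = trans (+-suc ∣ map isInner U ∣ _) (cong suc (wt-split U))

isInner⇒≡ : ∀ {l} → T (isInner l) → l ≡ inner
isInner⇒≡ {inner} _ = refl

isLeaf⇒≡ : ∀ {l} → T (isLeaf l) → l ≡ leaf
isLeaf⇒≡ {leaf} _ = refl

-- The flags stand for the inner vertex and the leaf. The leaf takes precedence if both are set,
-- which independence excludes.
limb : Bool → Bool → Limb
limb _     true  = leaf
limb true  false = inner
limb false false = none

limb-η : ∀ l → limb (isInner l) (isLeaf l) ≡ l
limb-η none  = refl
limb-η inner = refl
limb-η leaf  = refl

isInner-limb : ∀ a b → ¬ (T a × T b) → isInner (limb a b) ≡ a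
isInner-limb false false _  = refl
isInner-limb false true  _  = refl
isInner-limb true  false _  = refl
isInner-limb true  true  ¬∧ = contradiction (tt , tt) ¬∧

isLeaf-limb : ∀ a b → isLeaf (limb a b) ≡ b
isLeaf-limb a     true  = refl
isLeaf-limb true  false = refl
isLeaf-limb false false = refl

¬T⇒false : ∀ {b} → ¬ T b → b ≡ false
¬T⇒false {false} _  = refl
¬T⇒false {true}  ¬t = contradiction tt ¬t

-- A set without the root is given by its traces on the limbs. A set with the root has no inner
-- vertices, so its leaves determine it.
Code : ℕ → Set
Code k = Vec Limb k ⊎ Subset k

holds : ∀ {k} → Code k → Role k → Bool
holds (inj₁ U) root      = false
holds (inj₁ U) (inner i) = isInner (lookup U i)
holds (inj₁ U) (leaf i)  = isLeaf (lookup U i)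
holds (inj₂ S) root      = true
holds (inj₂ S) (inner i) = false
holds (inj₂ S) (leaf i)  = lookup S i

codeSize : ∀ {k} → Code k → ℕ
codeSize (inj₁ U) = wt U
codeSize (inj₂ S) = suc ∣ S ∣

holds-independent : ∀ {k} (z : Code k) {ρ σ} → Adj ρ σ → T (holds z ρ) → ¬ T (holds z σ)
holds-independent (inj₂ S) root-inner _ ()
holds-independent (inj₂ S) inner-root ()
holds-independent (inj₁ U) (inner-leaf {i}) s t with lookup U i
holds-independent (inj₁ U) (inner-leaf {i}) s () | inner
holds-independent (inj₁ U) (leaf-inner {i}) s t with lookup U i
holds-independent (inj₁ U) (leaf-inner {i}) s () | leaf

allRoles : ∀ k → List (Role k)
allRoles k = root ∷ (List.tabulate inner ++ List.tabulate leaf)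

∈-allRoles : ∀ {k} (ρ : Role k) → ρ ∈ₗ allRoles k
∈-allRoles root      = here refl
∈-allRoles (inner i) = there (∈-++⁺ˡ (∈-tabulate⁺ i))
∈-allRoles (leaf i)  = there (∈-++⁺ʳ (List.tabulate inner) (∈-tabulate⁺ i))

allRoles-unique : ∀ k → Unique (allRoles k)
allRoles-unique k = All.tabulate fresh ∷
  Unique.++⁺ (Unique.tabulate⁺ λ { refl → refl }) (Unique.tabulate⁺ λ { refl → refl }) apart
  where
  apart : ∀ {ρ} → ¬ (ρ ∈ₗ List.tabulate {n = k} inner × ρ ∈ₗ List.tabulate {n = k} leaf)
  apart (p , q) with ∈-tabulate⁻ p | ∈-tabulate⁻ q
  ... | _ , refl | _ , ()
  fresh : ∀ {ρ} → ρ ∈ₗ List.tabulate {n = k} inner ++ List.tabulate {n = k} leaf → root ≢ ρ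
  fresh ρ∈ refl with ∈-++⁻ (List.tabulate {n = k} inner) ρ∈
  ... | inj₁ p = case ∈-tabulate⁻ p of λ ()
  ... | inj₂ p = case ∈-tabulate⁻ p of λ ()

codeSize-length : ∀ {k} (z : Code k) → length (filter (T? ∘ holds z) (allRoles k)) ≡ codeSize z
codeSize-length {k} (inj₁ U) = begin
  length (filter p (List.tabulate inner ++ List.tabulate leaf))
    ≡⟨ length-filter-++ p (List.tabulate inner) _ ⟩
  length (filter p (List.tabulate inner)) + length (filter p (List.tabulate leaf))
    ≡⟨ cong₂ _+_ (length-filter-tabulate inner (holds (inj₁ U))) (length-filter-tabulate leaf (holds (inj₁ U))) ⟩
  ∣ tabulate (λ i → isInner (lookup U i)) ∣ + ∣ tabulate (λ i → isLeaf (lookup U i)) ∣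
    ≡⟨ cong₂ (λ X Y → ∣ X ∣ + ∣ Y ∣) (tabulate-lookup-map isInner) (tabulate-lookup-map isLeaf) ⟩
  ∣ map isInner U ∣ + ∣ leaves U ∣
    ≡⟨ wt-split U ⟩
  wt U ∎
  where
  open ≡-Reasoning
  p = T? ∘ holds (inj₁ U)
  tabulate-lookup-map : (f : Limb → Bool) → tabulate (λ i → f (lookup U i)) ≡ map f U
  tabulate-lookup-map f = trans (tabulate-cong λ i → sym (lookup-map i f U)) (tabulate∘lookup (map f U))
codeSize-length {k} (inj₂ S) = cong suc (begin
  length (filter p (List.tabulate inner ++ List.tabulate leaf))
    ≡⟨ length-filter-++ p (List.tabulate inner) _ ⟩
  length (filter p (List.tabulate inner)) + length (filter p (List.tabulate leaf))
    ≡⟨ cong₂ _+_ (length-filter-tabulate inner (holds (inj₂ S))) (length-filter-tabulate leaf (holds (inj₂ S))) ⟩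
  ∣ tabulate {n = k} (λ _ → outside) ∣ + ∣ tabulate (lookup S) ∣
    ≡⟨ cong₂ (λ x Y → x + ∣ Y ∣) (empty k) (tabulate∘lookup S) ⟩
  ∣ S ∣ ∎)
  where
  open ≡-Reasoning
  p = T? ∘ holds (inj₂ S)
  empty : ∀ k → ∣ tabulate {n = k} (λ _ → outside) ∣ ≡ 0
  empty zero    = refl
  empty (suc k) = empty k

module Coding {n : ℕ} (G : Graph n) {k : ℕ} (L : Limbs G k) where
  open Graph G
  open Limbs L

  decode : Code k → Subset n
  decode z = tabulate (holds z ∘ role)

  lookup-decode : ∀ z ρ → lookup (decode z) (vertex ρ) ≡ holds z ρ
  lookup-decode z ρ = trans (lookup∘tabulate (holds z ∘ role) (vertex ρ)) (cong (holds z) (role-vertex ρ))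

  ∈-decode⁺ : ∀ z ρ → T (holds z ρ) → vertex ρ ∈ decode z
  ∈-decode⁺ z ρ t = T⇒∈ (decode z) (vertex ρ) (subst T (sym (lookup-decode z ρ)) t)

  ∈-decode⁻ : ∀ z {v} → v ∈ decode z → T (holds z (role v))
  ∈-decode⁻ z {v} v∈ = subst T (lookup∘tabulate (holds z ∘ role) v) (∈⇒T v∈)

  decode-independent : ∀ z → Independent G (decode z)
  decode-independent z u v u∈ v∈ u~v = holds-independent z
    (adjacent (role u) (role v) (subst₂ _~_ (sym (vertex-role u)) (sym (vertex-role v)) u~v))
    (∈-decode⁻ z u∈) (∈-decode⁻ z v∈)

  encode : Subset n → Code k
  encode A = if lookup A (vertex root)
    then inj₂ (tabulate λ i → lookup A (vertex (leaf i)))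
    else inj₁ (tabulate λ i → limb (lookup A (vertex (inner i))) (lookup A (vertex (leaf i))))

  holds-encode : ∀ A → Independent G A → ∀ ρ → holds (encode A) ρ ≡ lookup A (vertex ρ)
  holds-encode A ind ρ with lookup A (vertex root) in eq
  holds-encode A ind root      | true  = sym eq
  holds-encode A ind (inner i) | true  = sym (¬T⇒false λ t →
    ind _ _ (T⇒∈ A _ (subst T (sym eq) tt)) (T⇒∈ A _ t) (root~inner i))
  holds-encode A ind (leaf i)  | true  = lookup∘tabulate _ i
  holds-encode A ind root      | false = sym eq
  holds-encode A ind (inner i) | false = trans (cong isInner (lookup∘tabulate _ i))
    (isInner-limb (lookup A (vertex (inner i))) _ λ (s , t) → ind _ _ (T⇒∈ A _ s) (T⇒∈ A _ t) (inner~leaf i))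
  holds-encode A ind (leaf i)  | false = trans (cong isLeaf (lookup∘tabulate _ i))
    (isLeaf-limb (lookup A (vertex (inner i))) _)

  decode-encode : ∀ A → Independent G A → decode (encode A) ≡ A
  decode-encode A ind = trans
    (tabulate-cong λ v → trans (holds-encode A ind (role v)) (cong (lookup A) (vertex-role v)))
    (tabulate∘lookup A)

  encode-decode : ∀ z → encode (decode z) ≡ z
  encode-decode (inj₁ U) rewrite lookup-decode (inj₁ U) root = cong inj₁ (trans
    (tabulate-cong λ i → trans
      (cong₂ limb (lookup-decode (inj₁ U) (inner i)) (lookup-decode (inj₁ U) (leaf i)))
      (limb-η (lookup U i)))
    (tabulate∘lookup U))
  encode-decode (inj₂ S) rewrite lookup-decode (inj₂ S) root = cong inj₂ (trans
    (tabulate-cong λ i → lookup-decode (inj₂ S) (leaf i))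
    (tabulate∘lookup S))

  -- `vertex` and `role` are mutually inverse, so the decoded set has as many vertices as the code
  -- holds roles.
  ∣decode∣ : ∀ z → ∣ decode z ∣ ≡ codeSize z
  ∣decode∣ z = trans (sym (length-filter-tabulate id (holds z ∘ role))) (trans (≤-antisym
    (unique-inj-length vertex (Unique.filter⁺ (T? ∘ holds z ∘ role) (Unique.allFin⁺ n)) (λ {v} _ → vertex-role v)
      λ {v} v∈ → ∈-filter⁺ (T? ∘ holds z) (∈-allRoles (role v))
        (proj₂ (∈-filter⁻ (T? ∘ holds z ∘ role) {xs = allFin n} v∈)))
    (unique-inj-length role (Unique.filter⁺ (T? ∘ holds z) (allRoles-unique k)) (λ {ρ} _ → role-vertex ρ)
      λ {ρ} ρ∈ → ∈-filter⁺ (T? ∘ holds z ∘ role) (∈-allFin (vertex ρ))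
        (subst (T ∘ holds z) (sym (role-vertex ρ)) (proj₂ (∈-filter⁻ (T? ∘ holds z) {xs = allRoles k} ρ∈)))))
    (codeSize-length z))

  codes : LimbFamily k → Family k → List (Code k)
  codes F H = List.map inj₁ (filter (T? ∘ F) (limbVectors k)) ++ List.map inj₂ (filter (T? ∘ H) (subsets k))

  length-codes : ∀ F H → length (codes F H) ≡ countL F + count H
  length-codes F H = trans (List.length-++ (List.map inj₁ (filter (T? ∘ F) (limbVectors k)))) (cong₂ _+_
    (trans (List.length-map inj₁ (filter (T? ∘ F) (limbVectors k))) (countL-length F))
    (trans (List.length-map inj₂ (filter (T? ∘ H) (subsets k))) (card-count (T? ∘ H))))

  codes-unique : ∀ F H → Unique (codes F H)
  codes-unique F H = Unique.++⁺
    (Unique.map⁺ (λ { refl → refl }) (Unique.filter⁺ _ (limbVectors-unique k)))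
    (Unique.map⁺ (λ { refl → refl }) (Unique.filter⁺ _ (subsets-unique k)))
    (map-disjoint λ _ _ ())

  ∈-codes⁺ : ∀ F H z → T ([ F , H ]′ z) → z ∈ₗ codes F H
  ∈-codes⁺ F H (inj₁ U) t = ∈-++⁺ˡ (∈-map⁺ inj₁ (∈-filter⁺ (T? ∘ F) (∈-limbVectors U) t))
  ∈-codes⁺ F H (inj₂ S) t = ∈-++⁺ʳ (List.map inj₁ (filter (T? ∘ F) (limbVectors k)))
    (∈-map⁺ inj₂ (∈-filter⁺ (T? ∘ H) (∈-subsets S) t))

  ∈-codes⁻ : ∀ F H z → z ∈ₗ codes F H → T ([ F , H ]′ z)
  ∈-codes⁻ F H z z∈ with ∈-++⁻ (List.map inj₁ (filter (T? ∘ F) (limbVectors k))) z∈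
  ... | inj₁ p with _ , U∈ , refl ← ∈-map⁻ inj₁ p = proj₂ (∈-filter⁻ (T? ∘ F) {xs = limbVectors k} U∈)
  ... | inj₂ p with _ , S∈ , refl ← ∈-map⁻ inj₂ p = proj₂ (∈-filter⁻ (T? ∘ H) {xs = subsets k} S∈)

  card-≤-codes : ∀ {𝒜 : Pred (Subset n) 0ℓ} (𝒜? : Decidable 𝒜) → 𝒜 ⊆ᵖ Independent G → ∀ F H →
    (∀ z → 𝒜 (decode z) → T ([ F , H ]′ z)) → card 𝒜? ≤ countL F + count H
  card-≤-codes {𝒜} 𝒜? ind F H h = subst (card 𝒜? ≤_) (length-codes F H)
    (unique-inj-length decode (Unique.filter⁺ 𝒜? (subsets-unique n))
      (λ A∈ → decode-encode _ (ind (mem A∈)))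
      (λ {A} A∈ → ∈-codes⁺ F H (encode A) (h (encode A) (subst 𝒜 (sym (decode-encode A (ind (mem A∈)))) (mem A∈)))))
    where
    mem : ∀ {A} → A ∈ₗ filter 𝒜? (subsets n) → 𝒜 A
    mem = proj₂ ∘ ∈-filter⁻ 𝒜? {xs = subsets n}

  codes-≤-card : ∀ {𝒜 : Pred (Subset n) 0ℓ} (𝒜? : Decidable 𝒜) F H →
    (∀ z → T ([ F , H ]′ z) → 𝒜 (decode z)) → countL F + count H ≤ card 𝒜?
  codes-≤-card 𝒜? F H h = subst (_≤ card 𝒜?) (length-codes F H)
    (unique-inj-length encode (codes-unique F H) (λ {z} _ → encode-decode z)
      (λ {z} z∈ → ∈-filter⁺ 𝒜? (∈-subsets (decode z)) (h z (∈-codes⁻ F H z z∈))))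

-- Maximal independent sets and largest stars

μ-≤ : ∀ {n} (G : Graph n) A → Independent G A →
  (∀ v → v ∈ A ⊎ ∃[ u ] u ∈ A × Graph._~_ G u v) → μ G ≤ ∣ A ∣
μ-≤ {n} G A ind dominates = Extrema.min≤v⁺ n _ (inj₂ (Any.map (≤-reflexive ∘ sym)
  (∈-map⁺ ∣_∣ (∈-filter⁺ (maximalIndependent? G) (∈-subsets A) (ind , maximal)))))
  where
  maximal : ¬ (∃[ B ] Independent G B × A ⊂ B)
  maximal (B , indB , A⊆B , v , v∈B , v∉A) with dominates v
  ... | inj₁ v∈A           = v∉A v∈A
  ... | inj₂ (u , u∈A , e) = indB u v (A⊆B u∈A) v∈B e

card-star≤largest : ∀ {n} (G : Graph n) r v → card (star? G r v) ≤ largestStarSize G r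
card-star≤largest {n} G r v = Extrema.v≤max⁺ 0 _ (inj₂ (Any.map ≤-reflexive
  (∈-map⁺ (λ v → card (star? G r v)) (∈-allFin v))))

-- The star at `v` is no larger than the largest star, hence no larger than `𝒜`, so the inclusion is
-- an equality.
isStar-from-⊆ : ∀ {n} (G : Graph n) r {𝒜 : Pred (Subset n) 0ℓ} (𝒜? : Decidable 𝒜) v →
  𝒜 ⊆ᵖ star G r v → largestStarSize G r ≤ card 𝒜? → IsStar G r 𝒜
isStar-from-⊆ G r 𝒜? v 𝒜⊆ large = v , 𝒜⊆ , λ {A} s → does-T (𝒜? A)
  (count-full (λ B → T-does (star? G r v B) ∘ 𝒜⊆ ∘ does-T (𝒜? B))
    (subst₂ _≤_ (card-count (star? G r v)) (card-count 𝒜?) (≤-trans (card-star≤largest G r v) large))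
    A (T-does (star? G r v A) s))

wt-inners : ∀ k → wt (replicate k inner) ≡ k
wt-inners zero    = refl
wt-inners (suc k) = cong suc (wt-inners k)

-- The inner vertices form a maximal independent set of size `k` if there is a limb. Otherwise the
-- root alone does, which accounts for the 1.
μ≤1⊔limbs : ∀ {n} (G : Graph n) {k} → Limbs G k → μ G ≤ 1 ⊔ k
μ≤1⊔limbs G {k} L = go k refl
  where
  open Graph G
  open Limbs L
  open Coding G L
  μ≤codeSize : ∀ z → (∀ ρ → T (holds z ρ) ⊎ ∃[ σ ] T (holds z σ) × vertex σ ~ vertex ρ) → μ G ≤ codeSize z
  μ≤codeSize z dominates = subst (μ G ≤_) (∣decode∣ z) (μ-≤ G (decode z) (decode-independent z) λ v →
    subst (λ w → w ∈ decode z ⊎ ∃[ u ] u ∈ decode z × u ~ w) (vertex-role v)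
      (Sum.map (∈-decode⁺ z (role v)) (λ (σ , t , e) → vertex σ , ∈-decode⁺ z σ t , e) (dominates (role v))))
  go : ∀ m → m ≡ k → μ G ≤ 1 ⊔ k
  go zero    refl = μ≤codeSize (inj₂ []) λ { root → inj₁ tt ; (inner ()) ; (leaf ()) }
  go (suc m) refl = subst (μ G ≤_) (wt-inners (suc m)) (μ≤codeSize (inj₁ (replicate k inner)) λ where
      root      → inj₂ (inner Fin.zero , tt , ~-sym (root~inner Fin.zero))
      (inner i) → inj₁ (held i)
      (leaf i)  → inj₂ (inner i , held i , inner~leaf i))
    where
    held : ∀ i → T (isInner (lookup (replicate k inner) i))
    held i = subst (T ∘ isInner) (sym (lookup-replicate i inner)) tt

-- Intersecting families as large as the largest star

module _ {n : ℕ} (G : Graph n) {k : ℕ} (L : Limbs G k) where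
  open Graph G
  open Limbs L
  open Coding G L

  large⇒star : ∀ {q} → 3 + 2 * q ≤ k → ∀ {𝒜 : Pred (Subset n) 0ℓ} (𝒜? : Decidable 𝒜) →
    𝒜 ⊆ᵖ 𝓘 G (2 + q) → Intersecting G 𝒜 → largestStarSize G (2 + q) ≤ card 𝒜? → IsStar G (2 + q) 𝒜
  large⇒star {q} 3+2q≤k {𝒜} 𝒜? 𝒜⊆𝓘 meets large =
    isStar-from-⊆ G r 𝒜? (vertex (leaf a)) 𝒜⊆star large
    where
    r = 2 + q
    F : LimbFamily k
    F U = does (𝒜? (decode (inj₁ U)))
    H : Family k
    H S = does (𝒜? (decode (inj₂ S)))
    size : ∀ z → 𝒜 (decode z) → codeSize z ≡ r
    size z A = trans (sym (∣decode∣ z)) (proj₂ (𝒜⊆𝓘 A))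
    common : ∀ z z′ → 𝒜 (decode z) → 𝒜 (decode z′) → ∃[ ρ ] T (holds z ρ) × T (holds z′ ρ)
    common z z′ A B with meets _ _ A B
    ... | v , v∈ = let p , p′ = x∈p∩q⁻ (decode z) (decode z′) v∈ in role v , ∈-decode⁻ z p , ∈-decode⁻ z′ p′
    FF : Cross Common F F
    FF U V f g with common (inj₁ U) (inj₁ V) (does-T (𝒜? _) f) (does-T (𝒜? _) g)
    ... | inner i , s , t = lookup-meet U V i (subst₂ Common (sym (isInner⇒≡ s)) (sym (isInner⇒≡ t)) inners)
    ... | leaf i  , s , t = lookup-meet U V i (subst₂ Common (sym (isLeaf⇒≡ s)) (sym (isLeaf⇒≡ t)) leafs)
    FH : Cross LeafIn F H
    FH U S f h with common (inj₁ U) (inj₂ S) (does-T (𝒜? _) f) (does-T (𝒜? _) h)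
    -- The first code lacks the root and the second all inner vertices, so the common vertex is a
    -- leaf.
    ... | leaf i  , s , t = lookup-meet U S i (s , t)
    star-≤ : ∀ a → countL (leafStar {k} a r) + count (rootStar {k} a (1 + q)) ≤ countL F + count H
    star-≤ a = begin
      countL (leafStar {k} a r) + count (rootStar {k} a (1 + q))
        ≤⟨ codes-≤-card (star? G r (vertex (leaf a))) (leafStar a r) (rootStar a (1 + q)) member ⟩
      card (star? G r (vertex (leaf a)))  ≤⟨ card-star≤largest G r (vertex (leaf a)) ⟩
      largestStarSize G r                 ≤⟨ large ⟩
      card 𝒜?                             ≤⟨ card-≤-codes 𝒜? (proj₁ ∘ 𝒜⊆𝓘) F H coded ⟩
      countL F + count H                  ∎
      where
      open ≤-Reasoning
      coded : ∀ z → 𝒜 (decode z) → T ([ F , H ]′ z)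
      coded (inj₁ U) = T-does (𝒜? _)
      coded (inj₂ S) = T-does (𝒜? _)
      in-star : ∀ z → T (holds z (leaf a)) → codeSize z ≡ r → star G r (vertex (leaf a)) (decode z)
      in-star z t eq = (decode-independent z , trans (∣decode∣ z) eq) , ∈-decode⁺ z (leaf a) t
      member : ∀ z → T ([ leafStar a r , rootStar a (1 + q) ]′ z) → star G r (vertex (leaf a)) (decode z)
      member (inj₁ U) t = let s , e = ∧-T {lookup (leaves U) a} t in
        in-star (inj₁ U) (subst T (lookup-leaves U a) s) (≡ᵇ⇒≡ (wt U) r e)
      member (inj₂ S) t = let s , e = ∧-T {lookup S a} t in
        in-star (inj₂ S) s (cong suc (≡ᵇ⇒≡ ∣ S ∣ (1 + q) e))
    module C = Centre 3+2q≤k F H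
      (λ U f → size (inj₁ U) (does-T (𝒜? _) f)) (λ S h → suc-injective (size (inj₂ S) (does-T (𝒜? _) h)))
      FF FH star-≤
    a = C.centre
    holds-centre : ∀ z → 𝒜 (decode z) → T (holds z (leaf a))
    holds-centre (inj₁ U) A = subst (T ∘ isLeaf) (sym (C.F-centre U (T-does (𝒜? _) A))) tt
    holds-centre (inj₂ S) A = C.H-centre S (T-does (𝒜? _) A)
    𝒜⊆star : 𝒜 ⊆ᵖ star G r (vertex (leaf a))
    𝒜⊆star {A} A∈ = 𝒜⊆𝓘 A∈ , subst (vertex (leaf a) ∈_) back
      (∈-decode⁺ (encode A) (leaf a) (holds-centre (encode A) (subst 𝒜 (sym back) A∈)))
      where back = decode-encode A (proj₁ (𝒜⊆𝓘 A∈))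

∣A∣≡1⇒unique : ∀ {n} {A : Subset n} {v w} → ∣ A ∣ ≡ 1 → v ∈ A → w ∈ A → w ≡ v
∣A∣≡1⇒unique {A = A} {v} {w} one v∈A w∈A with w Fin.≟ v
... | yes eq  = eq
... | no  w≢v = contradiction (subst₂ _<_ (∣⁅x⁆∣≡1 v) one (p⊂q⇒∣p∣<∣q∣ ⁅v⁆⊂A)) (n≮n 1)
  where
  ⁅v⁆⊂A : ⁅ v ⁆ ⊂ A
  ⁅v⁆⊂A = (λ x∈ → subst (_∈ A) (sym (x∈⁅y⁆⇒x≡y v x∈)) v∈A) , w , w∈A , w≢v ∘ x∈⁅y⁆⇒x≡y v

-- The case `r = 1`, outside the range of `Centre`. The star at `c` is nonempty, hence so is `𝒜`,
-- and intersecting singletons coincide.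
large⇒star₁ : ∀ {n} (G : Graph n) → Fin n → ∀ {𝒜 : Pred (Subset n) 0ℓ} (𝒜? : Decidable 𝒜) →
  𝒜 ⊆ᵖ 𝓘 G 1 → Intersecting G 𝒜 → largestStarSize G 1 ≤ card 𝒜? → IsStar G 1 𝒜
large⇒star₁ {n} G c {𝒜} 𝒜? 𝒜⊆𝓘 meets large with count-∃ (does ∘ 𝒜?) nonempty
  where
  open Graph G
  singleton-in-star : star G 1 c ⁅ c ⁆
  singleton-in-star = ((λ u v u∈ v∈ → ~-irrefl (trans (x∈⁅y⁆⇒x≡y c u∈) (sym (x∈⁅y⁆⇒x≡y c v∈)))) , ∣⁅x⁆∣≡1 c) , x∈⁅x⁆ c
  1≤star : 1 ≤ card (star? G 1 c)
  1≤star = unique-⊆-length {xs = ⁅ c ⁆ ∷ []} ([] ∷ [])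
    λ { (here refl) → ∈-filter⁺ (star? G 1 c) (∈-subsets ⁅ c ⁆) singleton-in-star }
  nonempty : count (does ∘ 𝒜?) ≢ 0
  nonempty empty = case subst (1 ≤_) (trans (card-count 𝒜?) empty)
    (≤-trans 1≤star (≤-trans (card-star≤largest G 1 c) large)) of λ ()
... | A , t with does-T (𝒜? A) t
... | A∈ with meets A A A∈ A∈
... | v , v∈ = isStar-from-⊆ G 1 𝒜? v (λ {B} B∈ → 𝒜⊆𝓘 B∈ , contains B B∈) large
  where
  contains : ∀ B → 𝒜 B → v ∈ B
  contains B B∈ =
    let w , w∈ = meets A B A∈ B∈
        w∈A , w∈B = x∈p∩q⁻ A B w∈
    in subst (_∈ B) (∣A∣≡1⇒unique (proj₂ (𝒜⊆𝓘 A∈)) (proj₁ (x∈p∩q⁻ A A v∈)) w∈A) w∈B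

large⇒star-strict : ∀ {n} (G : Graph n) r →
  (∀ {𝒜 : Pred (Subset n) 0ℓ} (𝒜? : Decidable 𝒜) → 𝒜 ⊆ᵖ 𝓘 G r → Intersecting G 𝒜 →
    largestStarSize G r ≤ card 𝒜? → IsStar G r 𝒜) → StrictlyEKR G r
large⇒star-strict G r isStar 𝒜? 𝒜⊆𝓘 meets ¬star = ≰⇒> (¬star ∘ isStar 𝒜? 𝒜⊆𝓘 meets)

theorem1p2 : (r : ℕ) → r ≥ 1 →
    (n : ℕ) (G : Graph n) (root : Fin n) → IsDepthTwoClaw G root →
    μ G ≥ 2 * r ∸ 1 → StrictlyEKR G r
theorem1p2 (suc zero)    _ n G c claw _   = large⇒star-strict G 1 (large⇒star₁ G c)
theorem1p2 (suc (suc q)) _ n G c claw μ≥ = large⇒star-strict G (2 + q) (large⇒star G (limbs G c claw) 3+2q≤k)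
  where
  3+2q≤1⊔k : 3 + 2 * q ≤ 1 ⊔ limbCount G c claw
  3+2q≤1⊔k = ≤-trans (≤-reflexive (cong (_∸ 1) (sym (*-distribˡ-+ 2 2 q))))
    (≤-trans μ≥ (μ≤1⊔limbs G (limbs G c claw)))
  3+2q≤k : 3 + 2 * q ≤ limbCount G c claw
  -- The maximum cannot be 1, because `3 + 2 * q` exceeds 1.
  3+2q≤k with ⊔-sel 1 (limbCount G c claw)
  ... | inj₁ eq = case ≤-trans 3+2q≤1⊔k (≤-reflexive eq) of λ { (s≤s ()) }
  ... | inj₂ eq = ≤-trans 3+2q≤1⊔k (≤-reflexive eq)
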